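{- For online square packing, every online algorithm has asymptotic competitive ratio at least $1.7515445$.
   Context: In square packing, the input is a sequence of squares whose side lengths are rational numbers in $(0,1]$. The squares must be packed into unit square bins, axis-parallel and non-overlapping, where two squares overlap only if their interiors intersect. The cost is the number of non-empty bins. In the online version, squares arrive one by one and each must be irrevocably placed (assigned to a bin at a position) before the next square is revealed. Online algorithms are deterministic. For an algorithm $A$ and input $I$, let $A(I)$ be its cost and $OPT(I)$ the minimum possible cost. Let $c(Q)=\max\{A(I): OPT(I)=Q\}$, and define the asymptotic competitive ratio as $R_A=\limsup_{Q\to\infty} c(Q)/Q$.
   Formalization: The positions at which squares are placed in bins, by the online algorithm and in the packings defining OPT, have rational coordinates; algorithms using irrational positions are not covered. -}

module Defs where

open import Data.Nat as ℕ using (ℕ)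
open import Data.Integer using (+_)
open import Data.Rational using (ℚ; _/_; _+_; _*_; _-_; _≤_; _<_; 0ℚ; 1ℚ)
open import Data.List using (List; []; _∷_; _++_; [_]; length; map; zip; deduplicate)
open import Data.List.Relation.Unary.All using (All)
open import Data.Product using (_×_; Σ; ∃; ∃-syntax; _,_)
open import Data.Sum using (_⊎_)
open import Data.Unit using (⊤)
open import Relation.Binary.PropositionalEquality using (_≡_; _≢_)

Side : Set
Side = ℚ

ValidInput : List Side → Set
ValidInput = All (λ s → (0ℚ < s) × (s ≤ 1ℚ))

-- A placement: a bin index and the position (x , y) of the lower-left corner.
record Placement : Set where
  constructor place
  field
    bin : ℕ
    x   : ℚ
    y   : ℚ
open Placement public

Fits : Side × Placement → Set
Fits (s , p) = (0ℚ ≤ x p) × (x p + s ≤ 1ℚ) × (0ℚ ≤ y p) × (y p + s ≤ 1ℚ)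

Disjoint : Side × Placement → Side × Placement → Set
Disjoint (s , p) (t , q) =
  (bin p ≢ bin q) ⊎ (x p + s ≤ x q) ⊎ (x q + t ≤ x p) ⊎ (y p + s ≤ y q) ⊎ (y q + t ≤ y p)

ValidPack : List (Side × Placement) → Set
ValidPack [] = ⊤
ValidPack (a ∷ as) = Fits a × All (Disjoint a) as × ValidPack as

Packs : List Side → List Placement → Set
Packs I ps = (length ps ≡ length I) × ValidPack (zip I ps)

cost : List Placement → ℕ
cost ps = length (deduplicate ℕ._≟_ (map bin ps))

IsOPT : List Side → ℕ → Set
IsOPT I Q = (∃[ ps ] (Packs I ps × cost ps ≡ Q))
          × (∀ ps → Packs I ps → Q ℕ.≤ cost ps)

runFrom : (List Side → Side → Placement) → List Side → List Side → List Placement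
runFrom f pre [] = []
runFrom f pre (s ∷ rest) = f pre s ∷ runFrom f (pre ++ [ s ]) rest

run : (List Side → Side → Placement) → List Side → List Placement
run f I = runFrom f [] I

record OnlineAlg : Set where
  field
    decide : List Side → Side → Placement
    valid  : ∀ I → ValidInput I → Packs I (run decide I)
open OnlineAlg public

algCost : OnlineAlg → List Side → ℕ
algCost A I = cost (run (decide A) I)

toℚ : ℕ → ℚ
toℚ n = (+ n) / 1

lowerBound : ℚ
lowerBound = (+ 17515445) / 10000000

-- limsup_{Q→∞} c(Q)/Q ≥ r, where c(Q) = max{A(I) : OPT(I) = Q}:
-- for every rational ε > 0 and every Q₀ there are Q ≥ Q₀ and an input I
-- with OPT(I) = Q and A(I) > (r − ε)·Q.
RatioAtLeast : OnlineAlg → ℚ → Set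
RatioAtLeast A r =
  ∀ (ε : ℚ) → 0ℚ < ε → ∀ (Q₀ : ℕ) →
    ∃[ Q ] ((Q₀ ℕ.≤ Q) × ∃[ I ] (ValidInput I × IsOPT I Q ×
      ((r - ε) * toℚ Q < toℚ (algCost A I))))

{-# OPTIONS --safe #-}

-- The adversary presents tiny squares of side slightly above 1/13, then squares of side 1/4 + a,
-- then squares of side 1/3 + a. The excesses a are found by bisection, so that afterwards some γ
-- separates "good" squares (a ≤ γ) from "bad" ones (a > γ), where the label of a square may depend
-- on the bin into which the algorithm has put it. Bad is the first 1/4-square of a bin, and the
-- first 1/3-square of a bin that contains at most four 1/4-squares. Hence squares of side 3/4 − γ
-- (presented after the second phase) and 2/3 − γ (presented after the third) fit into no bin of the
-- algorithm that contains a square of the preceding phase, while an optimal packing combines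
-- each of them with five, respectively three, good squares. The adversary stops after the tiny
-- squares, after the squares of side 3/4 − γ, or after those of side 2/3 − γ; a weighting of the bins
-- shows that one of these stops yields a ratio of at least 219/125 = 1.752. Optima are made exact by
-- finally filling all free area with minute squares.

module Submission where

open import Defs
open import Data.Bool using (Bool; T; _∧_; _∨_; false; if_then_else_; not; true)
open import Data.Bool.ListAction using (all)
open import Data.Bool.Properties using (T-∧; T-∨; T-≡; T?)
open import Data.Empty using (⊥; ⊥-elim)
open import Data.Integer as ℤ using (-[1+_])
import Data.Integer.Properties as ℤₚ
open import Data.List using (List; []; _++_; _∷_; applyUpTo; cartesianProduct; cartesianProductWith; concatMap; deduplicate; filter; length; map; replicate; reverse; upTo; zip; zipWith)
open import Data.List.Membership.Propositional using (_∈_; _∉_; lose)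
open import Data.List.Membership.Propositional.Properties
open import Data.List.Properties using (++-assoc; ++-identityʳ; filter-++; filter-accept; filter-reject; length-++; length-applyUpTo; length-map; length-replicate; length-upTo; map-++; map-∘; reverse-involutive; reverse-map; unfold-reverse)
open import Data.List.Relation.Binary.Subset.Propositional using (_⊆_)
open import Data.List.Relation.Unary.All as All using (All; []; _∷_)
import Data.List.Relation.Unary.All.Properties as Allₚ
open import Data.List.Relation.Unary.AllPairs as AllPairs using (AllPairs; []; _∷_)
import Data.List.Relation.Unary.AllPairs.Properties as AllPairsₚ
open import Data.List.Relation.Unary.Any using (here; there)
import Data.List.Relation.Unary.Any.Properties as Anyₚ
open import Data.List.Relation.Unary.Unique.Propositional using (Unique)
import Data.List.Relation.Unary.Unique.Propositional.Properties as Uniqueₚ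
open import Data.Nat using (>-nonZero; NonZero; _*_; _+_; _/_; _<?_; _<_; _<ᵇ_; _^_; _∸_; _≟_; _≤?_; _≤_; _≤ᵇ_; suc; s≤s; zero; z≤n; ℕ)
open import Data.Nat.DivMod using (+-distrib-/-∣ʳ; /-monoˡ-≤; _%_; m%n<n; m*n/n≡m; m/n*n≤m; m≡m%n+[m/n]*n; n/1≡n)
open import Data.Nat.Divisibility using (n∣m*n)
open import Data.Nat.ListAction using (sum)
open import Data.Nat.ListAction.Properties using (sum-++)
open import Data.Nat.Properties
open import Data.Nat.Solver using (module +-*-Solver)
open import Data.Product using (_,_; _×_; proj₁; proj₂; ∃-syntax)
open import Data.Product.Properties using (≡-dec)
open import Data.Rational as ℚ using (0ℚ; 1ℚ; mkℚ; ℚ; ↥_; ↧ₙ_)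
import Data.Rational.Properties as ℚₚ
open import Data.Rational.Unnormalised as ℚᵘ using (mkℚᵘ)
import Data.Rational.Unnormalised.Properties as ℚᵘₚ
open import Data.Sum using (_⊎_; inj₁; inj₂)
open import Data.Unit using (tt)
open import Function using (Equivalence; _∘_)
open import Relation.Binary.PropositionalEquality
open import Relation.Nullary using (Dec; contradiction; no; yes; ¬?; ¬_)
open import Relation.Nullary.Decidable using (map′)
open import Data.List.Membership.DecPropositional _≟_ using (_∈?_)
open import Data.List.Relation.Unary.Unique.DecPropositional.Properties _≟_ using (deduplicate-!)

-- Packings of integer squares

-- A bad square shuts its bin to the large squares of its phase, but it is expensive offline: it
-- cannot accompany a large square and is charged a ninth or a quarter of a bin without one. Hence
-- at most one square per bin is bad, and later squares of a shut bin can safely be good. An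
-- algorithm that opens many bins pays for them at the stop; one that opens few leaves most squares
-- good and so admits many large squares, each of which needs a new bin.
--
-- Since the algorithm is deterministic, the adversary can decide in hindsight: all three phases are
-- played to the end, bins are counted in that full history, and the large squares of a stop are
-- then presented to the prefix that ends with their phase.
--
-- All sides are multiples of 1/D for one D, so rounding positions down preserves a packing, and
-- areas become counts of grid cells. Each adaptive square costs one bisection step; therefore the
-- number of squares is fixed in advance and D has a factor 2 to the power 48M + 72M.

record Pos : Set where
  constructor pos
  field
    binOf colOf rowOf : ℕ
open Pos public

Square : Set
Square = ℕ × Pos

Inside : ℕ → Square → Set
Inside M (k , p) = (colOf p + k ≤ M) × (rowOf p + k ≤ M)

Apart : Square → Square → Set
Apart (k , p) (l , q) =
  (binOf p ≢ binOf q) ⊎ (colOf p + k ≤ colOf q) ⊎ (colOf q + l ≤ colOf p)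
                      ⊎ (rowOf p + k ≤ rowOf q) ⊎ (rowOf q + l ≤ rowOf p)

GridPacking : ℕ → List Square → Set
GridPacking M E = All (Inside M) E × AllPairs Apart E

square-bin : Square → ℕ
square-bin = binOf ∘ proj₂

area : Square → ℕ
area (k , _) = k * k

Cell : Set
Cell = ℕ × ℕ × ℕ

interval : ℕ → ℕ → List ℕ
interval c k = applyUpTo (c +_) k

cells : Square → List Cell
cells (k , pos b c r) = cartesianProduct (b ∷ []) (cartesianProduct (interval c k) (interval r k))

gridCells : ℕ → List ℕ → List Cell
gridCells M B = cartesianProduct B (cartesianProduct (upTo M) (upTo M))

module _ {A : Set} where

  remove : ∀ {x : A} {ys} → x ∈ ys → List A
  remove {ys = _ ∷ ys} (here _) = ys
  remove {ys = y ∷ _} (there x∈) = y ∷ remove x∈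

  length-remove : ∀ {x : A} {ys} (x∈ : x ∈ ys) → length ys ≡ suc (length (remove x∈))
  length-remove (here _) = refl
  length-remove (there x∈) = cong suc (length-remove x∈)

  ∈-remove : ∀ {x z : A} {ys} (x∈ : x ∈ ys) → x ≢ z → z ∈ ys → z ∈ remove x∈
  ∈-remove (here refl) x≢z (here refl) = contradiction refl x≢z
  ∈-remove (here refl) x≢z (there z∈) = z∈
  ∈-remove (there x∈) x≢z (here refl) = here refl
  ∈-remove (there x∈) x≢z (there z∈) = there (∈-remove x∈ x≢z z∈)

  -- The pigeonhole principle behind all counting: areas are compared through duplicate-free lists
  -- of cells, costs through duplicate-free lists of bins.
  Unique-⊆⇒length≤ : ∀ {xs ys : List A} → Unique xs → xs ⊆ ys → length xs ≤ length ys
  Unique-⊆⇒length≤ [] _ = z≤n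
  Unique-⊆⇒length≤ {xs = x ∷ xs} {ys} (x≢ ∷ u) sub =
    subst (suc (length xs) ≤_) (sym (length-remove x∈))
      (s≤s (Unique-⊆⇒length≤ u λ z∈ → ∈-remove x∈ (All.lookup x≢ z∈) (sub (there z∈))))
    where x∈ = sub (here refl)

length-cartesianProduct : ∀ {A B : Set} (xs : List A) (ys : List B) →
  length (cartesianProduct xs ys) ≡ length xs * length ys
length-cartesianProduct [] ys = refl
length-cartesianProduct (x ∷ xs) ys =
  trans (length-++ (map (x ,_) ys)) (cong₂ _+_ (length-map (x ,_) ys) (length-cartesianProduct xs ys))

interval-Unique : ∀ c k → Unique (interval c k)
interval-Unique c k = Uniqueₚ.applyUpTo⁺₁ (c +_) k λ i<j _ eq → <⇒≢ i<j (+-cancelˡ-≡ c _ _ eq)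

∈-interval⁻ : ∀ {c k i} → i ∈ interval c k → (c ≤ i) × (i < c + k)
∈-interval⁻ {c} i∈ with j , j<k , refl ← ∈-applyUpTo⁻ (c +_) i∈ = m≤m+n c j , +-monoʳ-< c j<k

∈-interval⁺ : ∀ {c k i} → c ≤ i → i < c + k → i ∈ interval c k
∈-interval⁺ {c} {k} {i} c≤i i< = subst (_∈ interval c k) (m+[n∸m]≡n c≤i)
  (∈-applyUpTo⁺ (c +_) (+-cancelˡ-< c (i ∸ c) k (subst (_< c + k) (sym (m+[n∸m]≡n c≤i)) i<)))

∈-cells⁻ : ∀ {k b c r b′ i j} → (b′ , i , j) ∈ cells (k , pos b c r) →
           (b′ ≡ b) × ((c ≤ i) × (i < c + k)) × ((r ≤ j) × (j < r + k))
∈-cells⁻ {k} {b} {c} {r} z∈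
  with b∈ , ij∈ ← ∈-cartesianProduct⁻ (b ∷ []) _ z∈
  with i∈ , j∈ ← ∈-cartesianProduct⁻ (interval c k) (interval r k) ij∈
  with here b≡ ← b∈
  = b≡ , ∈-interval⁻ i∈ , ∈-interval⁻ j∈

∈-cells⁺ : ∀ {k b c r i j} → c ≤ i → i < c + k → r ≤ j → j < r + k →
           (b , i , j) ∈ cells (k , pos b c r)
∈-cells⁺ {b = b′} a b c d =
  ∈-cartesianProduct⁺ {xs = b′ ∷ []} (here refl) (∈-cartesianProduct⁺ (∈-interval⁺ a b) (∈-interval⁺ c d))

cells-Unique : ∀ s → Unique (cells s)
cells-Unique (k , pos b c r) =
  Uniqueₚ.cartesianProduct⁺ {xs = b ∷ []} ([] ∷ []) (Uniqueₚ.cartesianProduct⁺ (interval-Unique c k) (interval-Unique r k))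

length-cells : ∀ s → length (cells s) ≡ area s
length-cells (k , pos b c r)
  rewrite length-cartesianProduct (b ∷ []) (cartesianProduct (interval c k) (interval r k))
        | length-cartesianProduct (interval c k) (interval r k)
        | length-applyUpTo (c +_) k | length-applyUpTo (r +_) k
  = +-identityʳ (k * k)

length-gridCells : ∀ M B → length (gridCells M B) ≡ length B * (M * M)
length-gridCells M B
  rewrite length-cartesianProduct B (cartesianProduct (upTo M) (upTo M))
        | length-cartesianProduct (upTo M) (upTo M) | length-upTo M = refl

Apart⇒cells-disjoint : ∀ {s t} → Apart s t → ∀ {z} → ¬ (z ∈ cells s × z ∈ cells t)
Apart⇒cells-disjoint {k , pos b c r} {l , pos b′ c′ r′} ap {_ , i , j} (z∈s , z∈t)
  with b≡ , (c≤ , <c) , (r≤ , <r) ← ∈-cells⁻ {k} {b} {c} {r} z∈s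
  with b′≡ , (c′≤ , <c′) , (r′≤ , <r′) ← ∈-cells⁻ {l} {b′} {c′} {r′} z∈t
  with ap
... | inj₁ b≢ = b≢ (trans (sym b≡) b′≡)
... | inj₂ (inj₁ le) = <-irrefl refl (<-≤-trans <c (≤-trans le c′≤))
... | inj₂ (inj₂ (inj₁ le)) = <-irrefl refl (<-≤-trans <c′ (≤-trans le c≤))
... | inj₂ (inj₂ (inj₂ (inj₁ le))) = <-irrefl refl (<-≤-trans <r (≤-trans le r′≤))
... | inj₂ (inj₂ (inj₂ (inj₂ le))) = <-irrefl refl (<-≤-trans <r′ (≤-trans le r≤))

cells-⊆-grid : ∀ {M B s} → Inside M s → square-bin s ∈ B → cells s ⊆ gridCells M B
cells-⊆-grid {M} {B} {k , pos b c r} (c≤ , r≤) b∈ {_ , i , j} z∈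
  with refl , (_ , <c) , (_ , <r) ← ∈-cells⁻ {k} {b} {c} {r} z∈
  = ∈-cartesianProduct⁺ b∈ (∈-cartesianProduct⁺ (∈-upTo⁺ (<-≤-trans <c c≤)) (∈-upTo⁺ (<-≤-trans <r r≤)))

covered : List Square → List Cell
covered = concatMap cells

length-covered : ∀ E → length (covered E) ≡ sum (map area E)
length-covered [] = refl
length-covered (s ∷ E) = trans (length-++ (cells s)) (cong₂ _+_ (length-cells s) (length-covered E))

covered-Unique : ∀ {E} → AllPairs Apart E → Unique (covered E)
covered-Unique {E} ap = Uniqueₚ.concat⁺ (Allₚ.map⁺ (All.universal cells-Unique E))
  (AllPairsₚ.map⁺ (AllPairs.map (λ {s} {t} → Apart⇒cells-disjoint {s} {t}) ap))

covered-⊆-grid : ∀ {M B E} → All (Inside M) E → All (λ s → square-bin s ∈ B) E → covered E ⊆ gridCells M B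
covered-⊆-grid {E = s ∷ E} (i ∷ is) (b ∷ bs) z∈ with ∈-++⁻ (cells s) z∈
... | inj₁ z∈s = cells-⊆-grid {s = s} i b z∈s
... | inj₂ z∈E = covered-⊆-grid is bs z∈E

-- Disjoint squares cover disjoint sets of cells, all from the grids of the bins in `B`. With all
-- bins of a packing as `B` this bounds the optimum from below; with a single bin it limits what
-- that bin can hold.
area-bound : ∀ {M E B} → GridPacking M E → All (λ s → square-bin s ∈ B) E →
             sum (map area E) ≤ length B * (M * M)
area-bound {M} {E} {B} (ins , ap) bs =
  subst₂ _≤_ (length-covered E) (length-gridCells M B)
    (Unique-⊆⇒length≤ (covered-Unique ap) (covered-⊆-grid ins bs))

/-shift : ∀ {a b} κ d .{{_ : NonZero d}} → a + κ * d ≤ b → a / d + κ ≤ b / d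
/-shift {a} {b} κ d le = begin
  a / d + κ           ≡⟨ cong (a / d +_) (m*n/n≡m κ d) ⟨
  a / d + κ * d / d   ≡⟨ +-distrib-/-∣ʳ a (n∣m*n κ) ⟨
  (a + κ * d) / d     ≤⟨ /-monoˡ-≤ d le ⟩
  b / d               ∎
  where
  open ≤-Reasoning

-- A square of side k in a D × D bin with κ/m < k/D meets at least κ × κ of the interior points
-- of the m × m subdivision; scaling down by m/D turns these into a packing of κ-squares.
module Subdivide (m D : ℕ) .{{_ : NonZero D}} where

  shrink : ℕ → Square → Square
  shrink κ (k , pos b c r) = κ , pos b (c * m / D) (r * m / D)

  shrink-≤ : ∀ {κ} k c {c′} → κ * D ≤ k * m → c + k ≤ c′ → c * m / D + κ ≤ c′ * m / D
  shrink-≤ {κ} k c {c′} κ≤ le = /-shift κ D (begin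
    c * m + κ * D  ≤⟨ +-monoʳ-≤ (c * m) κ≤ ⟩
    c * m + k * m  ≡⟨ *-distribʳ-+ m c k ⟨
    (c + k) * m    ≤⟨ *-monoˡ-≤ m le ⟩
    c′ * m         ∎)
    where
    open ≤-Reasoning

  -- Strictness of the hypothesis puts the far side of the shrunk square at an integer below m,
  -- hence into a grid of side m - 1. This is why a bin offers (m - 1)² points and not m².
  shrink-< : ∀ {κ} k c → κ * D < k * m → c + k ≤ D → c * m / D + κ < m
  shrink-< {κ} k c κ< le = *-cancelʳ-< D _ _ (begin-strict
    (c * m / D + κ) * D      ≡⟨ *-distribʳ-+ D (c * m / D) κ ⟩
    c * m / D * D + κ * D    ≤⟨ +-monoˡ-≤ (κ * D) (m/n*n≤m (c * m) D) ⟩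
    c * m + κ * D            <⟨ +-monoʳ-< (c * m) κ< ⟩
    c * m + k * m            ≡⟨ *-distribʳ-+ m c k ⟨
    (c + k) * m              ≤⟨ *-monoˡ-≤ m le ⟩
    D * m                    ≡⟨ *-comm D m ⟩
    m * D                    ∎)
    where
    open ≤-Reasoning

  shrink-Apart : ∀ {κ λ′} s t → κ * D ≤ proj₁ s * m → λ′ * D ≤ proj₁ t * m →
                 Apart s t → Apart (shrink κ s) (shrink λ′ t)
  shrink-Apart (k , pos b c r) (l , pos b′ c′ r′) κ≤ λ≤ = λ where
    (inj₁ b≢)                        → inj₁ b≢
    (inj₂ (inj₁ le))                 → inj₂ (inj₁ (shrink-≤ k c κ≤ le))
    (inj₂ (inj₂ (inj₁ le)))          → inj₂ (inj₂ (inj₁ (shrink-≤ l c′ λ≤ le)))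
    (inj₂ (inj₂ (inj₂ (inj₁ le))))   → inj₂ (inj₂ (inj₂ (inj₁ (shrink-≤ k r κ≤ le))))
    (inj₂ (inj₂ (inj₂ (inj₂ le))))   → inj₂ (inj₂ (inj₂ (inj₂ (shrink-≤ l r′ λ≤ le))))

  shrink-packing : ∀ {A : Set} (sq : A → Square) (w : A → ℕ) {E} → All (λ e → w e * D < proj₁ (sq e) * m) E →
    GridPacking D (map sq E) → GridPacking (m ∸ 1) (map (λ e → shrink (w e) (sq e)) E)
  shrink-packing sq w hs (ins , ap) = inside hs ins , apart hs ap
    where
    inside : ∀ {E} → All (λ e → w e * D < proj₁ (sq e) * m) E → All (Inside D) (map sq E) →
             All (Inside (m ∸ 1)) (map (λ e → shrink (w e) (sq e)) E)
    inside [] [] = []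
    inside {e ∷ E} (h ∷ hs) ((c≤ , r≤) ∷ is) =
      ( ∸-monoˡ-≤ 1 (shrink-< (proj₁ (sq e)) (colOf (proj₂ (sq e))) h c≤)
      , ∸-monoˡ-≤ 1 (shrink-< (proj₁ (sq e)) (rowOf (proj₂ (sq e))) h r≤)) ∷ inside hs is
    all-apart : ∀ {e E} → w e * D < proj₁ (sq e) * m → All (λ e → w e * D < proj₁ (sq e) * m) E →
                All (Apart (sq e)) (map sq E) →
                All (Apart (shrink (w e) (sq e))) (map (λ e → shrink (w e) (sq e)) E)
    all-apart _ [] [] = []
    all-apart h (h′ ∷ hs) (a ∷ as) = shrink-Apart _ _ (<⇒≤ h) (<⇒≤ h′) a ∷ all-apart h hs as
    apart : ∀ {E} → All (λ e → w e * D < proj₁ (sq e) * m) E → AllPairs Apart (map sq E) →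
            AllPairs Apart (map (λ e → shrink (w e) (sq e)) E)
    apart [] [] = []
    apart (h ∷ hs) (a ∷ as) = all-apart h hs a ∷ apart hs as

-- Rounding rational packings to integer ones

frac-≤-floor : ∀ A B e e′ .{{_ : NonZero e}} .{{_ : NonZero e′}} → A * e′ ≤ B * e → A / e ≤ B / e′
frac-≤-floor A B e e′ le = begin
  A / e              ≡⟨ m*n/n≡m (A / e) e′ ⟨
  A / e * e′ / e′    ≤⟨ /-monoˡ-≤ e′ (*-cancelʳ-≤ (A / e * e′) B e inner) ⟩
  B / e′             ∎
  where
  open ≤-Reasoning
  inner : A / e * e′ * e ≤ B * e
  inner = begin
    A / e * e′ * e   ≡⟨ *-assoc (A / e) e′ e ⟩
    A / e * (e′ * e) ≡⟨ cong (A / e *_) (*-comm e′ e) ⟩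
    A / e * (e * e′) ≡⟨ *-assoc (A / e) e e′ ⟨
    A / e * e * e′   ≤⟨ *-monoˡ-≤ e′ (m/n*n≤m A e) ⟩
    A * e′           ≤⟨ le ⟩
    B * e            ∎

module Scale (d : ℕ) where

  D : ℕ
  D = suc d

  opaque
    -- Opaque, so that the normalisation of `ℚ./` is never unfolded: outside this block everything
    -- about `frac` goes through `toℚᵘ-frac`.
    frac : ℕ → ℚ
    frac k = (ℤ.+ k) ℚ./ D

    toℚᵘ-frac : ∀ k → ℚ.toℚᵘ (frac k) ℚᵘ.≃ mkℚᵘ (ℤ.+ k) d
    toℚᵘ-frac k = ℚₚ.toℚᵘ-fromℚᵘ (mkℚᵘ (ℤ.+ k) d)

  frac-mono-≤ : ∀ {a b} → a ≤ b → frac a ℚ.≤ frac b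
  frac-mono-≤ {a} {b} a≤b = ℚₚ.toℚᵘ-cancel-≤ (begin
    ℚ.toℚᵘ (frac a)  ≃⟨ toℚᵘ-frac a ⟩
    mkℚᵘ (ℤ.+ a) d     ≤⟨ ℚᵘ.*≤* (ℤₚ.*-monoʳ-≤-nonNeg (ℤ.+ D) (ℤ.+≤+ a≤b)) ⟩
    mkℚᵘ (ℤ.+ b) d     ≃⟨ toℚᵘ-frac b ⟨
    ℚ.toℚᵘ (frac b)  ∎)
    where
    open ℚᵘₚ.≤-Reasoning

  frac-mono-< : ∀ {a b} → a < b → frac a ℚ.< frac b
  frac-mono-< {a} {b} a<b = ℚₚ.toℚᵘ-cancel-< (begin-strict
    ℚ.toℚᵘ (frac a)  ≃⟨ toℚᵘ-frac a ⟩
    mkℚᵘ (ℤ.+ a) d     <⟨ ℚᵘ.*<* (ℤₚ.*-monoʳ-<-pos (ℤ.+ D) (ℤ.+<+ a<b)) ⟩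
    mkℚᵘ (ℤ.+ b) d     ≃⟨ toℚᵘ-frac b ⟨
    ℚ.toℚᵘ (frac b)  ∎)
    where
    open ℚᵘₚ.≤-Reasoning

  frac-+ : ∀ a b → frac a ℚ.+ frac b ≡ frac (a + b)
  frac-+ a b = ℚₚ.toℚᵘ-injective (begin
    ℚ.toℚᵘ (frac a ℚ.+ frac b)              ≈⟨ ℚₚ.toℚᵘ-homo-+ (frac a) (frac b) ⟩
    ℚ.toℚᵘ (frac a) ℚᵘ.+ ℚ.toℚᵘ (frac b)    ≈⟨ ℚᵘₚ.+-cong (toℚᵘ-frac a) (toℚᵘ-frac b) ⟩
    mkℚᵘ (ℤ.+ a) d ℚᵘ.+ mkℚᵘ (ℤ.+ b) d          ≈⟨ ℚᵘ.*≡* eq ⟩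
    mkℚᵘ (ℤ.+ (a + b)) d                      ≈⟨ toℚᵘ-frac (a + b) ⟨
    ℚ.toℚᵘ (frac (a + b))                   ∎)
    where
    open ℚᵘₚ.≃-Reasoning
    eq : (ℤ.+ a ℤ.* ℤ.+ D ℤ.+ ℤ.+ b ℤ.* ℤ.+ D) ℤ.* ℤ.+ D ≡ ℤ.+ (a + b) ℤ.* ℤ.+ (D * D)
    eq = trans (cong (ℤ._* ℤ.+ D) (sym (ℤₚ.*-distribʳ-+ (ℤ.+ D) (ℤ.+ a) (ℤ.+ b))))
        (trans (ℤₚ.*-assoc (ℤ.+ (a + b)) (ℤ.+ D) (ℤ.+ D)) (cong (ℤ.+ (a + b) ℤ.*_) (sym (ℤₚ.pos-* D D))))

  frac-0 : frac 0 ≡ 0ℚ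
  frac-0 = ℚₚ.toℚᵘ-injective (ℚᵘₚ.≃-trans (toℚᵘ-frac 0) (ℚᵘ.*≡* refl))

  frac-D : frac D ≡ 1ℚ
  frac-D = ℚₚ.toℚᵘ-injective (ℚᵘₚ.≃-trans (toℚᵘ-frac D) (ℚᵘ.*≡* (ℤₚ.*-comm (ℤ.+ D) (ℤ.+ 1))))

  floorD : ℚ → ℕ
  floorD p = ℤ.∣ ↥ p ∣ * D / ↧ₙ p

  floorD-1 : floorD 1ℚ ≡ D
  floorD-1 = trans (n/1≡n (1 * D)) (*-identityˡ D)

  -- Multiplication by D turns the side `frac k` into the integer k, which passes through the
  -- rounding down unchanged. So moving all corners down to the grid keeps every separation.
  floorD-shift : ∀ {p q} k → 0ℚ ℚ.≤ p → 0ℚ ℚ.≤ q → p ℚ.+ frac k ℚ.≤ q → floorD p + k ≤ floorD q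
  floorD-shift {mkℚ -[1+ _ ] _ _} k (ℚ.*≤* ()) _ _
  floorD-shift {mkℚ (ℤ.+ _) _ _} {mkℚ -[1+ _ ] _ _} k _ (ℚ.*≤* ()) _
  floorD-shift {p@(mkℚ (ℤ.+ n) e _)} {q@(mkℚ (ℤ.+ n′) e′ _)} k _ _ le = begin
    n * D / suc e + k                   ≡⟨ cong (λ z → n * D / suc e + z) (m*n/n≡m k (suc e)) ⟨
    n * D / suc e + k * suc e / suc e   ≡⟨ +-distrib-/-∣ʳ (n * D) (n∣m*n k) ⟨
    (n * D + k * suc e) / suc e         ≤⟨ frac-≤-floor (n * D + k * suc e) (n′ * D) (suc e) (suc e′) ineq ⟩
    n′ * D / suc e′                     ∎
    where
    open ≤-Reasoning
    leᵘ : mkℚᵘ (ℤ.+ n) e ℚᵘ.+ mkℚᵘ (ℤ.+ k) d ℚᵘ.≤ mkℚᵘ (ℤ.+ n′) e′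
    leᵘ = ℚᵘₚ.≤-trans (ℚᵘₚ.≤-reflexive (ℚᵘₚ.≃-trans
            (ℚᵘₚ.+-congʳ (mkℚᵘ (ℤ.+ n) e) (ℚᵘₚ.≃-sym (toℚᵘ-frac k)))
            (ℚᵘₚ.≃-sym (ℚₚ.toℚᵘ-homo-+ p (frac k))))) (ℚₚ.toℚᵘ-mono-≤ le)
    toℕ : (ℤ.+ n ℤ.* ℤ.+ D ℤ.+ ℤ.+ k ℤ.* ℤ.+ suc e) ℤ.* ℤ.+ suc e′ ℤ.≤ ℤ.+ n′ ℤ.* ℤ.+ (suc e * D) →
          (n * D + k * suc e) * suc e′ ≤ n′ * (suc e * D)
    toℕ h = ℤₚ.drop‿+≤+ (subst₂ ℤ._≤_
      (trans (cong (ℤ._* ℤ.+ suc e′) (cong₂ ℤ._+_ (sym (ℤₚ.pos-* n D)) (sym (ℤₚ.pos-* k (suc e)))))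
             (sym (ℤₚ.pos-* (n * D + k * suc e) (suc e′))))
      (sym (ℤₚ.pos-* n′ (suc e * D))) h)
    ineq : (n * D + k * suc e) * suc e′ ≤ n′ * D * suc e
    ineq = subst ((n * D + k * suc e) * suc e′ ≤_)
      (trans (cong (n′ *_) (*-comm (suc e) D)) (sym (*-assoc n′ D (suc e)))) (toℕ (ℚᵘₚ.drop-*≤* leᵘ))

  floorD-≤D : ∀ {p} k → 0ℚ ℚ.≤ p → p ℚ.+ frac k ℚ.≤ 1ℚ → floorD p + k ≤ D
  floorD-≤D {p} k 0≤p le = subst (floorD p + k ≤_) floorD-1 (floorD-shift k 0≤p (ℚ.*≤* (ℤ.+≤+ z≤n)) le)

  place⁺ : Pos → Placement
  place⁺ (pos b c r) = place b (frac c) (frac r)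

  round : Placement → Pos
  round (place b x y) = pos b (floorD x) (floorD y)

  frac-nonneg : ∀ a → 0ℚ ℚ.≤ frac a
  frac-nonneg a = subst (ℚ._≤ frac a) frac-0 (frac-mono-≤ {0} {a} z≤n)

  frac-+-≤ : ∀ a k {b} → a + k ≤ b → frac a ℚ.+ frac k ℚ.≤ frac b
  frac-+-≤ a k {b} le = subst (ℚ._≤ frac b) (sym (frac-+ a k)) (frac-mono-≤ le)

  frac-+-≤1 : ∀ a k → a + k ≤ D → frac a ℚ.+ frac k ℚ.≤ 1ℚ
  frac-+-≤1 a k le = subst (frac a ℚ.+ frac k ℚ.≤_) frac-D (frac-+-≤ a k le)

  sized : Square → Side × Placement
  sized (k , p) = frac k , place⁺ p

  Inside⇒Fits : ∀ s → Inside D s → Fits (sized s)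
  Inside⇒Fits (k , pos b c r) (c≤ , r≤) = frac-nonneg c , frac-+-≤1 c k c≤ , frac-nonneg r , frac-+-≤1 r k r≤

  Apart⇒Disjoint : ∀ s t → Apart s t → Disjoint (sized s) (sized t)
  Apart⇒Disjoint (k , pos b c r) (l , pos b′ c′ r′) = λ where
    (inj₁ b≢)                        → inj₁ b≢
    (inj₂ (inj₁ le))                 → inj₂ (inj₁ (frac-+-≤ c k le))
    (inj₂ (inj₂ (inj₁ le)))          → inj₂ (inj₂ (inj₁ (frac-+-≤ c′ l le)))
    (inj₂ (inj₂ (inj₂ (inj₁ le))))   → inj₂ (inj₂ (inj₂ (inj₁ (frac-+-≤ r k le))))
    (inj₂ (inj₂ (inj₂ (inj₂ le))))   → inj₂ (inj₂ (inj₂ (inj₂ (frac-+-≤ r′ l le))))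

  rounded : ℕ → Placement → Square
  rounded k p = k , round p

  Fits⇒Inside : ∀ k p → Fits (frac k , p) → Inside D (rounded k p)
  Fits⇒Inside k p (0≤x , x≤ , 0≤y , y≤) = floorD-≤D k 0≤x x≤ , floorD-≤D k 0≤y y≤

  Disjoint⇒Apart : ∀ k p l q → Fits (frac k , p) → Fits (frac l , q) →
                   Disjoint (frac k , p) (frac l , q) → Apart (rounded k p) (rounded l q)
  Disjoint⇒Apart k p l q (0≤x , _ , 0≤y , _) (0≤x′ , _ , 0≤y′ , _) = λ where
    (inj₁ b≢)                        → inj₁ b≢
    (inj₂ (inj₁ le))                 → inj₂ (inj₁ (floorD-shift k 0≤x 0≤x′ le))
    (inj₂ (inj₂ (inj₁ le)))          → inj₂ (inj₂ (inj₁ (floorD-shift l 0≤x′ 0≤x le)))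
    (inj₂ (inj₂ (inj₂ (inj₁ le))))   → inj₂ (inj₂ (inj₂ (inj₁ (floorD-shift k 0≤y 0≤y′ le))))
    (inj₂ (inj₂ (inj₂ (inj₂ le))))   → inj₂ (inj₂ (inj₂ (inj₂ (floorD-shift l 0≤y′ 0≤y le))))

-- Exact optima

length≤cost : ∀ {L} ps → Unique L → L ⊆ map bin ps → length L ≤ cost ps
length≤cost ps u L⊆ = Unique-⊆⇒length≤ u (∈-deduplicate⁺ _≟_ ∘ L⊆)

cost≤length : ∀ {B} ps → map bin ps ⊆ B → cost ps ≤ length B
cost≤length ps ⊆B = Unique-⊆⇒length≤ (deduplicate-! (map bin ps)) (⊆B ∘ ∈-deduplicate⁻ _≟_ (map bin ps))

unit : Cell → Square
unit (b , i , j) = 1 , pos b i j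

-- A unit square in the same bin that is not separated from `s` along an axis has both coordinates
-- in the range of `s`, and then it is one of its cells.
∉-cells⇒Apart : ∀ {s z} → z ∉ cells s → Apart s (unit z)
∉-cells⇒Apart {k , pos b c r} {b′ , i , j} z∉ with b ≟ b′
... | no b≢ = inj₁ b≢
... | yes refl with i <? c
...   | yes i< = inj₂ (inj₂ (inj₁ (subst (_≤ c) (+-comm 1 i) i<)))
...   | no i≮ with i <? c + k
...     | no i≮′ = inj₂ (inj₁ (≮⇒≥ i≮′))
...     | yes i<′ with j <? r
...       | yes j< = inj₂ (inj₂ (inj₂ (inj₂ (subst (_≤ r) (+-comm 1 j) j<))))
...       | no j≮ with j <? r + k
...         | no j≮′ = inj₂ (inj₂ (inj₂ (inj₁ (≮⇒≥ j≮′))))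
...         | yes j<′ = contradiction (∈-cells⁺ (≮⇒≥ i≮) i<′ (≮⇒≥ j≮) j<′) z∉

unit-Apart : ∀ {z z′} → z ≢ z′ → Apart (unit z) (unit z′)
unit-Apart {b , i , j} z≢ = ∉-cells⇒Apart {unit (b , i , j)} λ z∈ →
  let b≡ , (i≤ , i<) , (j≤ , j<) = ∈-cells⁻ {1} {b} {i} {j} z∈ in
  z≢ (sym (cong₂ _,_ b≡ (cong₂ _,_ (squeeze i≤ i<) (squeeze j≤ j<))))
  where
  squeeze : ∀ {a x} → a ≤ x → x < a + 1 → x ≡ a
  squeeze {a} {x} a≤x x< = ≤-antisym (≤-pred (subst (x <_) (+-comm a 1) x<)) a≤x

module Filling (D Q : ℕ) (E : List Square) (E-packing : GridPacking D E)
               (E-bins : All (λ s → square-bin s < Q) E) where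

  open import Data.List.Membership.DecPropositional (≡-dec _≟_ (≡-dec _≟_ _≟_)) using () renaming (_∈?_ to _∈ᶜ?_)

  grid : List Cell
  grid = gridCells D (upTo Q)

  free : List Cell
  free = filter (λ z → ¬? (z ∈ᶜ? covered E)) grid

  fillers : List Square
  fillers = map unit free

  free⊆grid : ∀ {z} → z ∈ free → z ∈ grid
  free⊆grid z∈ = proj₁ (∈-filter⁻ (λ z → ¬? (z ∈ᶜ? covered E)) {xs = grid} z∈)

  free-uncovered : ∀ {z} → z ∈ free → z ∉ covered E
  free-uncovered z∈ = proj₂ (∈-filter⁻ (λ z → ¬? (z ∈ᶜ? covered E)) {xs = grid} z∈)

  grid-Unique : Unique grid
  grid-Unique = Uniqueₚ.cartesianProduct⁺ (Uniqueₚ.upTo⁺ Q) (Uniqueₚ.cartesianProduct⁺ (Uniqueₚ.upTo⁺ D) (Uniqueₚ.upTo⁺ D))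

  grid⊆ : grid ⊆ covered E ++ free
  grid⊆ {z} z∈ with z ∈ᶜ? covered E
  ... | yes z∈E = ∈-++⁺ˡ z∈E
  ... | no z∉E = ∈-++⁺ʳ (covered E) (∈-filter⁺ (λ z → ¬? (z ∈ᶜ? covered E)) z∈ z∉E)

  fillers-inside : All (λ s → Inside D s × square-bin s < Q) fillers
  fillers-inside = Allₚ.map⁺ (All.tabulate λ {z} z∈ → inside {z} (free⊆grid z∈))
    where
    inside : ∀ {z} → z ∈ grid → Inside D (unit z) × square-bin (unit z) < Q
    inside {b , i , j} z∈
      with b∈ , ij∈ ← ∈-cartesianProduct⁻ (upTo Q) (cartesianProduct (upTo D) (upTo D)) z∈
      with i∈ , j∈ ← ∈-cartesianProduct⁻ (upTo D) (upTo D) ij∈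
      = (subst (_≤ D) (+-comm 1 i) (∈-upTo⁻ i∈) , subst (_≤ D) (+-comm 1 j) (∈-upTo⁻ j∈)) , ∈-upTo⁻ b∈

  fillers-apart : AllPairs Apart fillers
  fillers-apart = AllPairsₚ.map⁺ (AllPairs.map unit-Apart (Uniqueₚ.filter⁺ (λ z → ¬? (z ∈ᶜ? covered E)) grid-Unique))

  E-fillers-apart : All (λ s → All (Apart s) fillers) E
  E-fillers-apart = All.tabulate λ {s} s∈E → Allₚ.map⁺ (All.tabulate λ {z} z∈ →
    ∉-cells⇒Apart {s} {z} λ z∈s → free-uncovered z∈ (∈-concatMap⁺ cells (lose s∈E z∈s)))

  filled : List Square
  filled = E ++ fillers

  filled-packing : GridPacking D filled
  filled-packing = Allₚ.++⁺ (proj₁ E-packing) (All.map proj₁ fillers-inside)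
                 , AllPairsₚ.++⁺ (proj₂ E-packing) fillers-apart E-fillers-apart

  filled-bins : All (λ s → square-bin s < Q) filled
  filled-bins = Allₚ.++⁺ E-bins (All.map proj₂ fillers-inside)

  sum-fillers : ∀ zs → sum (map area (map unit zs)) ≡ length zs
  sum-fillers [] = refl
  sum-fillers (z ∷ zs) = cong suc (sum-fillers zs)

  -- Each cell of the Q bins is covered or free, so the fillers leave no area over, and area alone
  -- then forces Q bins on every packing.
  filled-area : Q * (D * D) ≤ sum (map area filled)
  filled-area = begin
    Q * (D * D)                                          ≡⟨ cong (_* (D * D)) (length-upTo Q) ⟨
    length (upTo Q) * (D * D)                            ≡⟨ length-gridCells D (upTo Q) ⟨
    length grid                                          ≤⟨ Unique-⊆⇒length≤ grid-Unique grid⊆ ⟩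
    length (covered E ++ free)                           ≡⟨ length-++ (covered E) ⟩
    length (covered E) + length free                     ≡⟨ cong₂ _+_ (length-covered E) (sym (sum-fillers free)) ⟩
    sum (map area E) + sum (map area fillers)            ≡⟨ sum-++ (map area E) (map area fillers) ⟨
    sum (map area E ++ map area fillers)                 ≡⟨ cong sum (map-++ area E fillers) ⟨
    sum (map area filled)                                ∎
    where
    open ≤-Reasoning

runFrom-++ : ∀ f pre I J → runFrom f pre (I ++ J) ≡ runFrom f pre I ++ runFrom f (pre ++ I) J
runFrom-++ f pre [] J = cong (λ l → runFrom f l J) (sym (++-identityʳ pre))
runFrom-++ f pre (s ∷ I) J = cong (f pre s ∷_) (trans (runFrom-++ f (pre ++ s ∷ []) I J)
  (cong (λ l → runFrom f (pre ++ s ∷ []) I ++ runFrom f l J) (++-assoc pre (s ∷ []) I)))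

-- The strict inequality comes from ε > 0 and Q > 0 alone, so the adversary can work with non-strict
-- ratios.
scaled-bound : ∀ p d ε Q C → 0ℚ ℚ.< ε → 0 < Q → p * Q ≤ C * suc d →
               (((ℤ.+ p) ℚ./ suc d) ℚ.- ε) ℚ.* toℚ Q ℚ.< toℚ C
scaled-bound p d ε Q C 0<ε 0<Q le = ℚₚ.<-≤-trans (ℚₚ.*-monoˡ-<-pos (toℚ Q) {{Qpos}} r-ε<r) rQ≤C
  where
  r = (ℤ.+ p) ℚ./ suc d
  r-ε<r : r ℚ.- ε ℚ.< r
  r-ε<r = subst (r ℚ.- ε ℚ.<_) (ℚₚ.+-identityʳ r) (ℚₚ.+-monoʳ-< r (ℚₚ.neg-antimono-< 0<ε))
  toℚᵘ-ι : ∀ n → ℚ.toℚᵘ (toℚ n) ℚᵘ.≃ mkℚᵘ (ℤ.+ n) 0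
  toℚᵘ-ι n = ℚₚ.toℚᵘ-fromℚᵘ (mkℚᵘ (ℤ.+ n) 0)
  Qpos : ℚ.Positive (toℚ Q)
  Qpos = ℚₚ.normalize-pos Q 1 {{_}} {{>-nonZero 0<Q}}
  rQ≤C : r ℚ.* toℚ Q ℚ.≤ toℚ C
  rQ≤C = ℚₚ.toℚᵘ-cancel-≤ (begin
    ℚ.toℚᵘ (r ℚ.* toℚ Q)              ≃⟨ ℚₚ.toℚᵘ-homo-* r (toℚ Q) ⟩
    ℚ.toℚᵘ r ℚᵘ.* ℚ.toℚᵘ (toℚ Q)      ≃⟨ ℚᵘₚ.*-cong (ℚₚ.toℚᵘ-fromℚᵘ (mkℚᵘ (ℤ.+ p) d)) (toℚᵘ-ι Q) ⟩
    mkℚᵘ (ℤ.+ p) d ℚᵘ.* mkℚᵘ (ℤ.+ Q) 0    ≤⟨ ℚᵘ.*≤* cross ⟩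
    mkℚᵘ (ℤ.+ C) 0                      ≃⟨ toℚᵘ-ι C ⟨
    ℚ.toℚᵘ (toℚ C)                    ∎)
    where
    open ℚᵘₚ.≤-Reasoning
    cross : (ℤ.+ p ℤ.* ℤ.+ Q) ℤ.* ℤ.+ 1 ℤ.≤ ℤ.+ C ℤ.* ℤ.+ (suc d * 1)
    cross = subst₂ ℤ._≤_
      (trans (ℤₚ.pos-* p Q) (sym (ℤₚ.*-identityʳ (ℤ.+ p ℤ.* ℤ.+ Q))))
      (trans (cong (λ z → ℤ.+ (C * z)) (sym (*-identityʳ (suc d)))) (ℤₚ.pos-* C (suc d * 1)))
      (ℤ.+≤+ le)

module Optimum (d : ℕ) where
  open Scale d

  sides : List Square → List Side
  sides = map (frac ∘ proj₁)

  GridPacking⇒Packs : ∀ {E} → GridPacking D E → Packs (sides E) (map (place⁺ ∘ proj₂) E)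
  GridPacking⇒Packs {E} (ins , ap) = trans (length-map _ E) (sym (length-map _ E)) , disjoint ins ap
    where
    apart : ∀ {s E} → All (Apart s) E → All (Disjoint (sized s)) (zip (sides E) (map (place⁺ ∘ proj₂) E))
    apart [] = []
    apart {s} {t ∷ E} (a ∷ as) = Apart⇒Disjoint s t a ∷ apart as
    disjoint : ∀ {E} → All (Inside D) E → AllPairs Apart E → ValidPack (zip (sides E) (map (place⁺ ∘ proj₂) E))
    disjoint [] [] = tt
    disjoint {s ∷ E} (i ∷ is) (a ∷ as) = Inside⇒Fits s i , apart a , disjoint is as

  -- Serves two kinds of packings at arbitrary rational positions: those competing for the optimum
  -- and those of the algorithm.
  Packs⇒GridPacking : ∀ ks ps → Packs (map frac ks) ps → GridPacking D (zipWith rounded ks ps)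
  Packs⇒GridPacking ks ps (_ , v) = ins ks ps v , pairs ks ps v
    where
    ins : ∀ ks ps → ValidPack (zip (map frac ks) ps) → All (Inside D) (zipWith rounded ks ps)
    ins [] _ _ = []
    ins (k ∷ ks) [] _ = []
    ins (k ∷ ks) (p ∷ ps) (f , _ , v) = Fits⇒Inside k p f ∷ ins ks ps v
    apart : ∀ k p ks ps → Fits (frac k , p) → All (Disjoint (frac k , p)) (zip (map frac ks) ps) →
            ValidPack (zip (map frac ks) ps) → All (Apart (rounded k p)) (zipWith rounded ks ps)
    apart k p [] _ f _ _ = []
    apart k p (_ ∷ _) [] f _ _ = []
    apart k p (l ∷ ks) (q ∷ ps) f (a ∷ as) (g , _ , v) = Disjoint⇒Apart k p l q f g a ∷ apart k p ks ps f as v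
    pairs : ∀ ks ps → ValidPack (zip (map frac ks) ps) → AllPairs Apart (zipWith rounded ks ps)
    pairs [] _ _ = []
    pairs (k ∷ ks) [] _ = []
    pairs (k ∷ ks) (p ∷ ps) (f , as , v) = apart k p ks ps f as v ∷ pairs ks ps v

  sum-areas : ∀ ks ps → length ps ≡ length ks → sum (map area (zipWith rounded ks ps)) ≡ sum (map (λ k → k * k) ks)
  sum-areas [] [] _ = refl
  sum-areas (k ∷ ks) (p ∷ ps) eq = cong (λ z → k * k + z) (sum-areas ks ps (suc-injective eq))

  rounded-bins : ∀ {B : List ℕ} ks ps → map bin ps ⊆ B → All (λ s → square-bin s ∈ B) (zipWith rounded ks ps)
  rounded-bins [] _ _ = []
  rounded-bins (k ∷ ks) [] _ = []
  rounded-bins (k ∷ ks) (p ∷ ps) ⊆B = ⊆B (here refl) ∷ rounded-bins ks ps (⊆B ∘ there)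

  area≤cost : ∀ {Q} E → Q * (D * D) ≤ sum (map area E) → ∀ ps → Packs (sides E) ps → Q ≤ cost ps
  area≤cost {Q} E Q≤ ps packs = *-cancelʳ-≤ Q (cost ps) (D * D) (begin
    Q * (D * D)                                  ≤⟨ Q≤ ⟩
    sum (map area E)                             ≡⟨ cong sum (map-∘ {g = λ k → k * k} {f = proj₁} E) ⟩
    sum (map (λ k → k * k) ks)                   ≡⟨ sum-areas ks ps len ⟨
    sum (map area (zipWith rounded ks ps))       ≤⟨ area-bound (Packs⇒GridPacking ks ps packs′)
                                                     (rounded-bins ks ps (∈-deduplicate⁺ _≟_)) ⟩
    cost ps * (D * D)                            ∎)
    where
    open ≤-Reasoning
    ks = map proj₁ E
    packs′ : Packs (map frac ks) ps
    packs′ = subst (λ I → Packs I ps) (map-∘ E) packs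
    len : length ps ≡ length ks
    len = trans (proj₁ packs′) (length-map frac ks)

  sides-valid : ∀ {E} → All (λ s → 0 < proj₁ s) E → All (Inside D) E → ValidInput (sides E)
  sides-valid [] [] = []
  sides-valid {(k , pos b c r) ∷ E} (0<k ∷ ps) ((c≤ , _) ∷ is) =
    ( subst (ℚ._< frac k) frac-0 (frac-mono-< 0<k)
    , subst (frac k ℚ.≤_) frac-D (frac-mono-≤ (≤-trans (m≤n+m k c) c≤))) ∷ sides-valid ps is

  -- Filling the free cells of the given packing by tiny squares pins down the optimum by area,
  -- and the additional squares can only increase the cost of the algorithm.
  stop : ∀ (A : OnlineAlg) p e ε Q₀ Q (E : List Square) (L : List ℕ) → 0ℚ ℚ.< ε → Q₀ ≤ Q → 0 < Q →
    GridPacking D E → All (λ s → square-bin s < Q) E → All (λ s → 0 < proj₁ s) E →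
    Unique L → L ⊆ map bin (run (decide A) (sides E)) → p * Q ≤ length L * suc e →
    ∃[ Q ] ((Q₀ ≤ Q) × ∃[ I ] (ValidInput I × IsOPT I Q ×
      (((((ℤ.+ p) ℚ./ suc e) ℚ.- ε) ℚ.* toℚ Q) ℚ.< toℚ (algCost A I))))
  stop A p e ε Q₀ Q E L 0<ε Q₀≤Q 0<Q packing bins pos-sides u L⊆ le =
    Q , Q₀≤Q , I , sides-valid pos-filled (proj₁ filled-packing)
      , ((placements , packs , ≤-antisym cost≤Q (lower placements packs)) , lower)
      , scaled-bound p e ε Q (algCost A I) 0<ε 0<Q
          (≤-trans le (*-monoˡ-≤ (suc e) (length≤cost (run (decide A) I) u L⊆I)))
    where
    open Filling D Q E packing bins
    I = sides filled
    placements = map (place⁺ ∘ proj₂) filled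
    packs = GridPacking⇒Packs filled-packing
    lower = area≤cost filled filled-area
    pos-filled : All (λ s → 0 < proj₁ s) filled
    pos-filled = Allₚ.++⁺ pos-sides (Allₚ.map⁺ (All.universal (λ _ → s≤s z≤n) free))
    placed-bins : ∀ {F} → All (λ s → square-bin s < Q) F → map bin (map (place⁺ ∘ proj₂) F) ⊆ upTo Q
    placed-bins (b< ∷ _) (here refl) = ∈-upTo⁺ b<
    placed-bins (_ ∷ bs) (there b∈) = placed-bins bs b∈
    cost≤Q : cost placements ≤ Q
    cost≤Q = subst (cost placements ≤_) (length-upTo Q) (cost≤length placements (placed-bins filled-bins))
    run-I : run (decide A) I ≡ run (decide A) (sides E) ++ runFrom (decide A) (sides E) (sides fillers)
    run-I = trans (cong (run (decide A)) (map-++ (frac ∘ proj₁) E fillers)) (runFrom-++ (decide A) [] (sides E) (sides fillers))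
    L⊆I : L ⊆ map bin (run (decide A) I)
    L⊆I {b} b∈ = subst (λ ps → b ∈ map bin ps) (sym run-I)
      (subst (b ∈_) (sym (map-++ bin (run (decide A) (sides E)) _)) (∈-++⁺ˡ (L⊆ b∈)))

-- Offline packings from templates

-- `good` and `bad` refer to the latest adaptive phase, and `big` to the large squares presented
-- after it. `middle` is for the 1/4-squares once the 1/3-squares have arrived, when their old
-- labels no longer matter.
data Role : Set where
  tiny middle good bad big : Role

private
  code : Role → ℕ
  code tiny = 0
  code middle = 1
  code good = 2
  code bad = 3
  code big = 4

  decode : ℕ → Role
  decode 0 = tiny
  decode 1 = middle
  decode 2 = good
  decode 3 = bad
  decode _ = big

  decode-code : ∀ ρ → decode (code ρ) ≡ ρ
  decode-code tiny = refl
  decode-code middle = refl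
  decode-code good = refl
  decode-code bad = refl
  decode-code big = refl

_≟ᴿ_ : (ρ σ : Role) → Dec (ρ ≡ σ)
ρ ≟ᴿ σ = map′ (λ eq → trans (sym (decode-code ρ)) (trans (cong decode eq) (decode-code σ))) (cong code)
              (code ρ ≟ code σ)

tally : Role → Role → ℕ
tally ρ σ with ρ ≟ᴿ σ
... | yes _ = 1
... | no  _ = 0

count : ∀ {A : Set} → Role → List (Role × A) → ℕ
count ρ [] = 0
count ρ ((σ , _) ∷ xs) = tally ρ σ + count ρ xs

tally-refl : ∀ ρ → tally ρ ρ ≡ 1
tally-refl ρ with ρ ≟ᴿ ρ
... | yes _ = refl
... | no ρ≢ρ = contradiction refl ρ≢ρ

count-++ : ∀ {A : Set} ρ (xs ys : List (Role × A)) → count ρ (xs ++ ys) ≡ count ρ xs + count ρ ys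
count-++ ρ [] ys = refl
count-++ ρ ((σ , _) ∷ xs) ys = trans (cong (tally ρ σ +_) (count-++ ρ xs ys)) (sym (+-assoc (tally ρ σ) _ _))

data Select {A : Set} (x : A) : List A → List A → Set where
  here  : ∀ {xs} → Select x xs (x ∷ xs)
  there : ∀ {y xs ys} → Select x xs ys → Select x (y ∷ xs) (y ∷ ys)

select : ∀ {A : Set} ρ (xs : List (Role × A)) → 0 < count ρ xs → ∃[ a ] ∃[ ys ] Select (ρ , a) ys xs
select ρ ((σ , a) ∷ xs) pos-count with ρ ≟ᴿ σ
... | yes refl = a , xs , here
... | no _ with b , ys , s ← select ρ xs pos-count = b , (σ , a) ∷ ys , there s

Select-count : ∀ {A : Set} {ρ σ} {a : A} {ys xs} → Select (ρ , a) ys xs → count σ xs ≡ tally σ ρ + count σ ys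
Select-count here = refl
Select-count {ρ = ρ} {σ} (there {y = τ , _} {xs = zs} {ys = ys} s) = begin
  tally σ τ + count σ ys                 ≡⟨ cong (tally σ τ +_) (Select-count s) ⟩
  tally σ τ + (tally σ ρ + count σ zs)   ≡⟨ +-assoc (tally σ τ) _ _ ⟨
  tally σ τ + tally σ ρ + count σ zs     ≡⟨ cong (_+ count σ zs) (+-comm (tally σ τ) (tally σ ρ)) ⟩
  tally σ ρ + tally σ τ + count σ zs     ≡⟨ +-assoc (tally σ ρ) _ _ ⟩
  tally σ ρ + (tally σ τ + count σ zs)   ∎
  where
  open ≡-Reasoning

Select-All : ∀ {A : Set} {P : A → Set} {x ys xs} → Select x ys xs → All P xs → P x × All P ys
Select-All here (p ∷ ps) = p , ps
Select-All (there s) (p ∷ ps) with q , qs ← Select-All s ps = q , p ∷ qs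

Select-AllPairs : ∀ {A : Set} {R : A → A → Set} → (∀ {x y} → R x y → R y x) →
  ∀ {x ys xs} → Select x ys xs → AllPairs R xs → All (R x) ys × AllPairs R ys
Select-AllPairs sym-R here (r ∷ rs) = r , rs
Select-AllPairs sym-R (there s) (r ∷ rs) with q , qs ← Select-AllPairs sym-R s rs | r′ , rs′ ← Select-All s r
  = sym-R r′ ∷ q , rs′ ∷ qs

Apart-sym : ∀ {s t} → Apart s t → Apart t s
Apart-sym = λ where
  (inj₁ b≢)                        → inj₁ (b≢ ∘ sym)
  (inj₂ (inj₁ le))                 → inj₂ (inj₂ (inj₁ le))
  (inj₂ (inj₂ (inj₁ le)))          → inj₂ (inj₁ le)
  (inj₂ (inj₂ (inj₂ (inj₁ le))))   → inj₂ (inj₂ (inj₂ (inj₂ le)))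
  (inj₂ (inj₂ (inj₂ (inj₂ le))))   → inj₂ (inj₂ (inj₂ (inj₁ le)))

Apart-shrinkʳ : ∀ {s l l′ q} → l′ ≤ l → Apart s (l , q) → Apart s (l′ , q)
Apart-shrinkʳ {q = pos _ c r} le = λ where
  (inj₁ b≢)                        → inj₁ b≢
  (inj₂ (inj₁ h))                  → inj₂ (inj₁ h)
  (inj₂ (inj₂ (inj₁ h)))           → inj₂ (inj₂ (inj₁ (≤-trans (+-monoʳ-≤ c le) h)))
  (inj₂ (inj₂ (inj₂ (inj₁ h))))    → inj₂ (inj₂ (inj₂ (inj₁ h)))
  (inj₂ (inj₂ (inj₂ (inj₂ h))))    → inj₂ (inj₂ (inj₂ (inj₂ (≤-trans (+-monoʳ-≤ r le) h))))

module Allocation (D : ℕ) (cap : Role → ℕ) where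

  full : Role × Pos → Square
  full (ρ , p) = cap ρ , p

  Slots : List (Role × Pos) → Set
  Slots pool = All (Inside D ∘ full) pool × AllPairs (λ s t → Apart (full s) (full t)) pool

  -- Each item takes the corner of some slot of its role, and a square no larger than its slot stays
  -- apart from whatever the slot was apart from. The last component strengthens the induction: it
  -- separates the first item from those placed later, of which only the pool of their slots is
  -- known.
  allocate : ∀ {Q} (items : List (Role × ℕ)) pool → (∀ ρ → count ρ items ≤ count ρ pool) →
    All (λ (ρ , k) → k ≤ cap ρ) items → Slots pool → All (λ (_ , p) → binOf p < Q) pool →
    ∃[ E ] ((map proj₁ E ≡ map proj₂ items) × GridPacking D E × All (λ s → square-bin s < Q) E ×
            (∀ s → All (Apart s ∘ full) pool → All (Apart s) E))
  allocate [] pool _ _ _ _ = [] , refl , ([] , []) , [] , λ _ _ → []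
  allocate {Q} ((ρ , k) ∷ items) pool enough (k≤ ∷ ks≤) (ins , ap) bins
    with p , rest , s ← select ρ pool (≤-trans (subst (λ z → 1 ≤ z + count ρ items) (sym (tally-refl ρ)) (s≤s z≤n)) (enough ρ))
    with in-p , in-rest ← Select-All s ins
       | ap-p , ap-rest ← Select-AllPairs (λ {x} {y} → Apart-sym {full x} {full y}) s ap
       | b-p , b-rest ← Select-All s bins
    with E , sizes , (insE , apE) , binsE , sep ← allocate {Q} items rest
           (λ σ → +-cancelˡ-≤ (tally σ ρ) _ _ (subst (tally σ ρ + count σ items ≤_) (Select-count s) (enough σ)))
           ks≤ (in-rest , ap-rest) b-rest
    = (k , p) ∷ E , cong (k ∷_) sizes
    , ( (≤-trans (+-monoʳ-≤ (colOf p) k≤) (proj₁ in-p) , ≤-trans (+-monoʳ-≤ (rowOf p) k≤) (proj₂ in-p)) ∷ insE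
      , sep (k , p) (All.map (λ {t} a → Apart-sym {full t} {k , p} (Apart-shrinkʳ {full t} k≤ (Apart-sym {cap ρ , p} {full t} a))) ap-p) ∷ apE)
    , b-p ∷ binsE
    , λ t aps → let a , as = Select-All s aps in Apart-shrinkʳ {t} k≤ a ∷ sep t as

-- An affine function of γ ∈ [0 , U], given by its slopes: (u , v) stands for u γ + v (U − γ).
-- Such functions are compared by comparing both components.
Affine : Set
Affine = ℕ × ℕ

const : ℕ → Affine
const n = n , n

_⊕_ : Affine → Affine → Affine
(u , v) ⊕ (u′ , v′) = u + u′ , v + v′

_≼ᵇ_ : Affine → Affine → Bool
(u , v) ≼ᵇ (u′ , v′) = (u ≤ᵇ u′) ∧ (v ≤ᵇ v′)

Slot : Set
Slot = Role × Affine × Affine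

Template : Set
Template = List Slot

module Check (M : ℕ) (cap : Role → Affine) where

  fits : Slot → Bool
  fits (ρ , x , y) = ((x ⊕ cap ρ) ≼ᵇ const M) ∧ ((y ⊕ cap ρ) ≼ᵇ const M)

  apart : Slot → Slot → Bool
  apart (ρ , x , y) (σ , x′ , y′) =
    ((x ⊕ cap ρ) ≼ᵇ x′) ∨ (((x′ ⊕ cap σ) ≼ᵇ x) ∨ (((y ⊕ cap ρ) ≼ᵇ y′) ∨ ((y′ ⊕ cap σ) ≼ᵇ y)))

  allApart : Slot → Template → Bool
  allApart s [] = true
  allApart s (t ∷ ts) = apart s t ∧ allApart s ts

  -- Works on slopes only, so one evaluation validates a template for every γ.
  check : Template → Bool
  check [] = true
  check (s ∷ ts) = fits s ∧ (allApart s ts ∧ check ts)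

  -- Here `g` stands for γ and `h` for U - γ, so that bins have side M U.
  module Realise (g h : ℕ) where

    value : Affine → ℕ
    value (u , v) = u * g + v * h

    value-⊕ : ∀ a b → value (a ⊕ b) ≡ value a + value b
    value-⊕ (u , v) (u′ , v′) = solve 6 (λ u u′ v v′ g h →
      (u :+ u′) :* g :+ (v :+ v′) :* h := (u :* g :+ v :* h) :+ (u′ :* g :+ v′ :* h)) refl u u′ v v′ g h
      where
      open +-*-Solver

    value-≤ : ∀ {a b} → T (a ≼ᵇ b) → value a ≤ value b
    value-≤ {u , v} {u′ , v′} t with p , q ← Equivalence.to (T-∧ {u ≤ᵇ u′} {v ≤ᵇ v′}) t
      = +-mono-≤ (*-monoˡ-≤ g (≤ᵇ⇒≤ u u′ p)) (*-monoˡ-≤ h (≤ᵇ⇒≤ v v′ q))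

    value-⊕-≤ : ∀ a b {c} → T ((a ⊕ b) ≼ᵇ c) → value a + value b ≤ value c
    value-⊕-≤ a b {c} t = subst (_≤ value c) (value-⊕ a b) (value-≤ {a ⊕ b} t)

    open Allocation (M * (g + h)) (value ∘ cap) public

    at : ℕ → Slot → Role × Pos
    at b (ρ , x , y) = ρ , pos b (value x) (value y)

    value-const : ∀ n → value (const n) ≡ n * (g + h)
    value-const n = sym (*-distribˡ-+ n g h)

    fits-sound : ∀ b s → T (fits s) → Inside (M * (g + h)) (full (at b s))
    fits-sound b (ρ , x , y) t with p , q ← Equivalence.to (T-∧ {(x ⊕ cap ρ) ≼ᵇ const M}) t
      = subst (value x + value (cap ρ) ≤_) (value-const M) (value-⊕-≤ x (cap ρ) p)
      , subst (value y + value (cap ρ) ≤_) (value-const M) (value-⊕-≤ y (cap ρ) q)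

    apart-sound : ∀ b s t → T (apart s t) → Apart (full (at b s)) (full (at b t))
    apart-sound b (ρ , x , y) (σ , x′ , y′) h with Equivalence.to (T-∨ {(x ⊕ cap ρ) ≼ᵇ x′}) h
    ... | inj₁ p = inj₂ (inj₁ (value-⊕-≤ x (cap ρ) p))
    ... | inj₂ h with Equivalence.to (T-∨ {(x′ ⊕ cap σ) ≼ᵇ x}) h
    ...   | inj₁ p = inj₂ (inj₂ (inj₁ (value-⊕-≤ x′ (cap σ) p)))
    ...   | inj₂ h with Equivalence.to (T-∨ {(y ⊕ cap ρ) ≼ᵇ y′}) h
    ...     | inj₁ p = inj₂ (inj₂ (inj₂ (inj₁ (value-⊕-≤ y (cap ρ) p))))
    ...     | inj₂ p = inj₂ (inj₂ (inj₂ (inj₂ (value-⊕-≤ y′ (cap σ) p))))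

    check-sound : ∀ b ts → T (check ts) → Slots (map (at b) ts)
    check-sound b [] _ = [] , []
    check-sound b (s ∷ ts) t
      with f , t ← Equivalence.to (T-∧ {fits s}) t
      with a , t ← Equivalence.to (T-∧ {allApart s ts}) t
      with ins , aps ← check-sound b ts t
      = fits-sound b s f ∷ ins , all-sound ts a ∷ aps
      where
      all-sound : ∀ ts → T (allApart s ts) → All (λ t → Apart (full (at b s)) (full t)) (map (at b) ts)
      all-sound [] _ = []
      all-sound (t ∷ ts) h with a , as ← Equivalence.to (T-∧ {apart s t}) h = apart-sound b s t a ∷ all-sound ts as

    build : ℕ → List Template → List (Role × Pos)
    build b [] = []
    build b (ts ∷ Ts) = map (at b) ts ++ build (suc b) Ts

    build-bins : ∀ b Ts → All (λ (_ , p) → (b ≤ binOf p) × (binOf p < b + length Ts)) (build b Ts)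
    build-bins b [] = []
    build-bins b (ts ∷ Ts) = Allₚ.++⁺
      (Allₚ.map⁺ (All.universal (λ _ → ≤-refl , subst (b <_) (sym (+-suc b (length Ts))) (s≤s (m≤m+n b _))) ts))
      (All.map (λ (p , q) → ≤-trans (n≤1+n b) p , ≤-trans q (≤-reflexive (sym (+-suc b (length Ts))))) (build-bins (suc b) Ts))

    build-Slots : ∀ b Ts → All (T ∘ check) Ts → Slots (build b Ts)
    build-Slots b [] [] = [] , []
    build-Slots b (ts ∷ Ts) (c ∷ cs) with ins , aps ← check-sound b ts c | inss , apss ← build-Slots (suc b) Ts cs
      = Allₚ.++⁺ ins inss , AllPairsₚ.++⁺ aps apss
          (Allₚ.map⁺ (All.universal (λ s → All.map (λ (b< , _) → inj₁ (<⇒≢ b<)) (build-bins (suc b) Ts)) ts))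

    count-at : ∀ ρ b ts → count ρ (map (at b) ts) ≡ count ρ ts
    count-at ρ b [] = refl
    count-at ρ b ((σ , _) ∷ ts) = cong (tally ρ σ +_) (count-at ρ b ts)

    count-build : ∀ ρ b Ts → count ρ (build b Ts) ≡ sum (map (count ρ) Ts)
    count-build ρ b [] = refl
    count-build ρ b (ts ∷ Ts) = trans (count-++ ρ (map (at b) ts) _) (cong₂ _+_ (count-at ρ b ts) (count-build ρ (suc b) Ts))

    sum-replicate : ∀ (f : Template → ℕ) m ts → sum (map f (replicate m ts)) ≡ m * f ts
    sum-replicate f zero ts = refl
    sum-replicate f (suc m) ts = cong (f ts +_) (sum-replicate f m ts)

    -- Squares of one role are interchangeable, so comparing the numbers of squares and slots role
    -- by role is enough.
    pack-items : ∀ m n S R → T (check S) → T (check R) → (items : List (Role × ℕ)) →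
      (∀ ρ → count ρ items ≤ m * count ρ S + n * count ρ R) →
      All (λ (ρ , k) → k ≤ value (cap ρ)) items →
      ∃[ E ] ((map proj₁ E ≡ map proj₂ items) × GridPacking (M * (g + h)) E × All (λ s → square-bin s < m + n) E)
    pack-items m n S R cS cR items enough caps =
      let E , sizes , packing , bins , _ = allocate {m + n} items (build 0 Ts)
            (λ ρ → subst (count ρ items ≤_) (sym (count-Ts ρ)) (enough ρ)) caps
            (build-Slots 0 Ts (Allₚ.++⁺ (Allₚ.replicate⁺ m cS) (Allₚ.replicate⁺ n cR)))
            (All.map (λ (_ , b<) → subst (_ <_) length-Ts b<) (build-bins 0 Ts))
      in E , sizes , packing , bins
      where
      Ts = replicate m S ++ replicate n R
      length-Ts : length Ts ≡ m + n
      length-Ts = trans (length-++ (replicate m S)) (cong₂ _+_ (length-replicate m) (length-replicate n))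
      count-Ts : ∀ ρ → count ρ (build 0 Ts) ≡ m * count ρ S + n * count ρ R
      count-Ts ρ = trans (count-build ρ 0 Ts) (trans (cong sum (map-++ (count ρ) (replicate m S) (replicate n R)))
        (trans (sum-++ (map (count ρ) (replicate m S)) _) (cong₂ _+_ (sum-replicate (count ρ) m S) (sum-replicate (count ρ) n R))))

block : Role → Affine → Affine → ℕ → ℕ → ℕ → Template
block ρ (u , v) (u′ , v′) step columns rows =
  cartesianProductWith (λ i j → ρ , const (i * step) ⊕ (u , v) , const (j * step) ⊕ (u′ , v′)) (upTo columns) (upTo rows)

-- Lengths are in units of 1/480 of a bin: a tiny square has side 37 > 480/13, and the excesses a
-- lie between 0 and 1, so that squares of side 1/4 + a and 1/3 + a take at most 121 and 161 units.
module Quarter where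
  cap : Role → Affine
  cap tiny = const 37
  cap middle = const 0
  cap good = 121 , 120
  cap bad = const 121
  cap big = 359 , 360

  open Check 480 cap public

  -- The slopes of `big` and `good` add up to 480 in both components: the strip beside a big square
  -- is as wide as a good square, whatever γ is. Both mixed templates offer at least three tiny
  -- squares per 1/4-square.
  gridBins largeBins smallBins : Template
  gridBins = block tiny (const 0) (const 0) 37 12 12
  largeBins = (big , const 0 , const 0) ∷ (good , e , e) ∷
    block good e (const 0) 121 1 2 ++ block good (const 0) e 121 2 1 ++
    block tiny e (const 242) 37 3 3 ++ block tiny (const 242) e 37 3 3
    where e = 359 , 360
  smallBins = block bad (const 0) (const 0) 121 3 3 ++ block tiny (const 363) (const 0) 37 3 9

module Third where
  cap : Role → Affine
  cap tiny = const 37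
  cap middle = const 121
  cap good = 161 , 160
  cap bad = const 161
  cap big = 319 , 320

  open Check 480 cap public

  -- Both templates are tight. In the strip beside the big square, a 1/3-, a 1/4- and a tiny square
  -- need 161 + 121 + 37 = 319, the least side of `big`; in `smallBins` the columns need 322 + 37 +
  -- 121 = 480.
  largeBins smallBins : Template
  largeBins = (big , const 0 , const 0) ∷ (good , e , e) ∷ (good , e , const 0) ∷ (good , const 0 , e) ∷
    (middle , e , const 161) ∷ (middle , const 161 , e) ∷
    block tiny e (const 282) 37 3 1 ++ block tiny (const 282) e 37 1 3
    where e = 319 , 320
  smallBins = block bad (const 0) (const 0) 161 2 2 ++ block middle (const 359) (const 0) 121 1 3 ++
    block tiny (const 322) (const 0) 37 1 8

_ : T (Quarter.check Quarter.gridBins) × T (Quarter.check Quarter.largeBins) × T (Quarter.check Quarter.smallBins)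
_ = _
_ : T (Third.check Third.largeBins) × T (Third.check Third.smallBins)
_ = _

-- The algorithm and the adaptive phases

module _ {A : Set} where

  All-reverse : ∀ {P : A → Set} {xs} → All P xs → All P (reverse xs)
  All-reverse [] = []
  All-reverse {P} {x ∷ xs} (p ∷ ps) =
    subst (All P) (sym (unfold-reverse x xs)) (Allₚ.++⁺ (All-reverse ps) (p ∷ []))

  AllPairs-reverse : ∀ {R : A → A → Set} → (∀ {x y} → R x y → R y x) →
                     ∀ {xs} → AllPairs R xs → AllPairs R (reverse xs)
  AllPairs-reverse sym-R [] = []
  AllPairs-reverse {R} sym-R {x ∷ xs} (r ∷ rs) = subst (AllPairs R) (sym (unfold-reverse x xs))
    (AllPairsₚ.++⁺ (AllPairs-reverse sym-R rs) ([] ∷ []) (All-reverse (All.map (λ h → sym-R h ∷ []) r)))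

GridPacking-reverse : ∀ {M E} → GridPacking M E → GridPacking M (reverse E)
GridPacking-reverse (ins , ap) = All-reverse ins , AllPairs-reverse (λ {s} {t} → Apart-sym {s} {t}) ap

record Entry : Set where
  constructor entry
  field
    size   : ℕ
    isGood : Bool
    placed : Placement
open Entry public

entry-bin : Entry → ℕ
entry-bin = bin ∘ placed

badBins : List Entry → List ℕ
badBins [] = []
badBins (e ∷ S) = if isGood e then badBins S else entry-bin e ∷ badBins S

roundedEntry : ℕ → Entry → Square
roundedEntry d e = Scale.rounded d (size e) (placed e)

module Play (A : OnlineAlg) (d : ℕ) where
  open Scale d
  open Optimum d

  -- Histories list the most recent square first.
  inputs : List Entry → List Side
  inputs H = map (frac ∘ size) (reverse H)

  outputs : List Entry → List Placement
  outputs H = map placed (reverse H)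

  Played : List Entry → Set
  Played H = run (decide A) (inputs H) ≡ outputs H

  next : List Entry → ℕ → Placement
  next H k = decide A (inputs H) (frac k)

  play-next : ∀ H k g → Played H → Played (entry k g (next H k) ∷ H)
  play-next H k g played = begin
    run f (inputs (e ∷ H))                                    ≡⟨ cong (run f ∘ map (frac ∘ size)) (unfold-reverse e H) ⟩
    run f (map (frac ∘ size) (reverse H ++ e ∷ []))           ≡⟨ cong (run f) (map-++ (frac ∘ size) (reverse H) (e ∷ [])) ⟩
    run f (inputs H ++ frac k ∷ [])                           ≡⟨ runFrom-++ f [] (inputs H) (frac k ∷ []) ⟩
    run f (inputs H) ++ next H k ∷ []                         ≡⟨ cong (_++ next H k ∷ []) played ⟩
    outputs H ++ next H k ∷ []                                ≡⟨ map-++ placed (reverse H) (e ∷ []) ⟨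
    map placed (reverse H ++ e ∷ [])                          ≡⟨ cong (map placed) (unfold-reverse e H) ⟨
    outputs (e ∷ H)                                           ∎
    where
    open ≡-Reasoning
    f = decide A
    e = entry k g (next H k)

  ValidSize : Entry → Set
  ValidSize e = (0 < size e) × (size e ≤ D)

  -- The only place where the validity of the algorithm enters: whatever it has done becomes a grid
  -- packing, to which the counting bounds apply.
  played-packing : ∀ {H} → Played H → All ValidSize H → GridPacking D (map (roundedEntry d) H)
  played-packing {H} played sizes =
    subst (GridPacking D) (trans (sym (reverse-map (roundedEntry d) (reverse H))) (cong (map (roundedEntry d)) (reverse-involutive H)))
      (GridPacking-reverse (subst (GridPacking D) (zip-map (reverse H))
        (Packs⇒GridPacking (map size (reverse H)) (outputs H)
          (subst₂ Packs (map-∘ (reverse H)) played (valid A (inputs H) (Allₚ.map⁺ (All.map (λ {e} → side-valid {e}) (All-reverse sizes))))))))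
    where
    side-valid : ∀ {e} → ValidSize e → (0ℚ ℚ.< frac (size e)) × (frac (size e) ℚ.≤ ℚ.1ℚ)
    side-valid {e} (0<k , k≤D) = subst (ℚ._< frac (size e)) frac-0 (frac-mono-< 0<k)
                               , subst (frac (size e) ℚ.≤_) frac-D (frac-mono-≤ k≤D)
    zip-map : ∀ H → zipWith rounded (map size H) (map placed H) ≡ map (roundedEntry d) H
    zip-map [] = refl
    zip-map (e ∷ H) = cong (roundedEntry d e ∷_) (zip-map H)

  Outcome : ℚ.ℚ → ℚ.ℚ → ℕ → Set
  Outcome r ε Q₀ = ∃[ Q ] ((Q₀ ≤ Q) × ∃[ I ] (ValidInput I × IsOPT I Q × ((r ℚ.- ε) ℚ.* toℚ Q ℚ.< toℚ (algCost A I))))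

  -- `E` is an offline repacking of the squares of `H` in the same order, so both describe the same
  -- input.
  stop-history : ∀ p e ε Q₀ Q H E L → 0ℚ ℚ.< ε → Q₀ ≤ Q → 0 < Q → Played H → All ValidSize H →
    map proj₁ E ≡ map size H → GridPacking D E → All (λ s → square-bin s < Q) E →
    Unique L → L ⊆ map entry-bin H → p * Q ≤ length L * suc e → Outcome ((ℤ.+ p) ℚ./ suc e) ε Q₀
  stop-history p e ε Q₀ Q H E L 0<ε Q₀≤Q 0<Q played sizes E≡ packing bins u L⊆ le =
    stop A p e ε Q₀ Q (reverse E) L 0<ε Q₀≤Q 0<Q (GridPacking-reverse packing) (All-reverse bins)
      (Allₚ.map⁻ (subst (All (0 <_)) (sym sizes≡) (Allₚ.map⁺ (All.map proj₁ (All-reverse sizes)))))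
      u (λ b∈ → subst (_ ∈_) run-bins (Anyₚ.reverse⁺ (L⊆ b∈))) le
    where
    sizes≡ : map proj₁ (reverse E) ≡ map size (reverse H)
    sizes≡ = trans (reverse-map proj₁ E) (trans (cong reverse E≡) (sym (reverse-map size H)))
    sides≡ : sides (reverse E) ≡ inputs H
    sides≡ = trans (map-∘ (reverse E)) (trans (cong (map frac) sizes≡) (sym (map-∘ (reverse H))))
    run-bins : reverse (map entry-bin H) ≡ map bin (run (decide A) (sides (reverse E)))
    run-bins = trans (sym (reverse-map entry-bin H)) (trans (map-∘ (reverse H))
      (cong (map bin) (sym (trans (cong (run (decide A)) sides≡) played))))

  -- Squares of side base + a with a found by bisection: a bad square lowers the upper end of the
  -- search interval and a good one raises the lower end, so that good squares end up with
  -- a ≤ lo and bad ones with a ≥ hi > lo.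
  record Bisected (base U : ℕ) (open? : ℕ → Bool) (H S : List Entry) (lo hi : ℕ) : Set where
    field
      played     : Played (S ++ H)
      hi≤U       : hi ≤ U
      goods      : All (λ e → isGood e ≡ true → (base < size e) × (size e ≤ base + lo)) S
      bads       : All (λ e → isGood e ≡ false → (base + hi ≤ size e) × (size e ≤ base + U)) S
      bad-open   : All (λ b → open? b ≡ true) (badBins S)
      bad-unique : Unique (badBins S)
      blocked    : All (λ e → open? (entry-bin e) ≡ true → entry-bin e ∈ badBins S) S
  open Bisected public

  module _ {base U : ℕ} {open? : ℕ → Bool} {H : List Entry} where

    private
      good-step : ∀ {S lo mid hi} → lo < mid → mid ≤ hi → (s : Bisected base U open? H S lo hi) →
        let p = next (S ++ H) (base + mid) in
        (open? (bin p) ≡ true → bin p ∈ badBins S) →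
        Bisected base U open? H (entry (base + mid) true p ∷ S) mid hi
      good-step {S} {lo} {mid} lo<mid mid≤hi s covered = record
        { played     = play-next (S ++ H) (base + mid) true (played s)
        ; hi≤U       = hi≤U s
        ; goods      = (λ _ → m<m+n base (≤-<-trans z≤n lo<mid) , ≤-refl)
                     ∷ All.map (λ h g → proj₁ (h g) , ≤-trans (proj₂ (h g)) (+-monoʳ-≤ base (<⇒≤ lo<mid))) (goods s)
        ; bads       = (λ ()) ∷ bads s
        ; bad-open   = bad-open s
        ; bad-unique = bad-unique s
        ; blocked    = covered ∷ blocked s
        }

      bad-step : ∀ {S lo mid hi} → mid < hi → (s : Bisected base U open? H S lo hi) →
        let p = next (S ++ H) (base + mid) in
        open? (bin p) ≡ true → bin p ∉ badBins S →
        Bisected base U open? H (entry (base + mid) false p ∷ S) lo mid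
      bad-step {S} {mid = mid} mid<hi s open-p new = record
        { played     = play-next (S ++ H) (base + mid) false (played s)
        ; hi≤U       = ≤-trans (<⇒≤ mid<hi) (hi≤U s)
        ; goods      = (λ ()) ∷ goods s
        ; bads       = (λ _ → ≤-refl , +-monoʳ-≤ base (≤-trans (<⇒≤ mid<hi) (hi≤U s)))
                     ∷ All.map (λ h b → ≤-trans (+-monoʳ-≤ base (<⇒≤ mid<hi)) (proj₁ (h b)) , proj₂ (h b)) (bads s)
        ; bad-open   = open-p ∷ bad-open s
        ; bad-unique = Allₚ.¬Any⇒All¬ _ new ∷ bad-unique s
        ; blocked    = (λ _ → here refl) ∷ All.map (λ h o → there (h o)) (blocked s)
        }

    -- One halving per square: a width of 2 ^ (n + r) serves n squares, and the remaining 2 ^ r > 0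
    -- is the gap that separates good from bad.
    bisect : ∀ n r {S lo} → Bisected base U open? H S lo (lo + 2 ^ (n + r)) →
      ∃[ S′ ] ∃[ lo′ ] (Bisected base U open? H S′ lo′ (lo′ + 2 ^ r) × (length S′ ≡ n + length S))
    bisect zero r {S} {lo} s = S , lo , s , refl
    bisect (suc n) r {S} {lo} s = case-open (open? (bin p)) refl
      where
      half = 2 ^ (n + r)
      mid = lo + half
      -- The side is `base + mid` under either label, so the algorithm commits to a bin before the
      -- label is chosen.
      p = next (S ++ H) (base + mid)
      lo<mid : lo < mid
      lo<mid = m<m+n lo (m^n>0 2 (n + r))
      hi≡ : lo + 2 ^ (suc n + r) ≡ mid + half
      hi≡ = trans (cong (λ z → lo + (half + z)) (+-identityʳ half)) (sym (+-assoc lo half half))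
      s′ : Bisected base U open? H S lo (mid + half)
      s′ = subst (Bisected base U open? H S lo) hi≡ s
      continue : ∀ {e lo′} → Bisected base U open? H (e ∷ S) lo′ (lo′ + half) →
        ∃[ S′ ] ∃[ lo″ ] (Bisected base U open? H S′ lo″ (lo″ + 2 ^ r) × (length S′ ≡ suc n + length S))
      continue t with S′ , lo″ , t′ , len ← bisect n r t = S′ , lo″ , t′ , trans len (+-suc n (length S))
      case-open : ∀ o → open? (bin p) ≡ o →
        ∃[ S′ ] ∃[ lo″ ] (Bisected base U open? H S′ lo″ (lo″ + 2 ^ r) × (length S′ ≡ suc n + length S))
      case-open false eq = continue (good-step lo<mid (m≤m+n mid half) s′ λ eq′ → contradiction (trans (sym eq) eq′) λ ())
      case-open true eq with bin p ∈? badBins S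
      ... | yes p∈ = continue (good-step lo<mid (m≤m+n mid half) s′ λ _ → p∈)
      ... | no p∉ = continue (bad-step (m<m+n mid (m^n>0 2 (n + r))) s′ eq p∉)

  repeat : ∀ n k H → Played H → ∃[ S ] (Played (S ++ H) × All (λ e → size e ≡ k) S × (length S ≡ n))
  repeat zero k H played = [] , played , [] , refl
  repeat (suc n) k H played with S , played′ , sizes , len ← repeat n k H played
    = entry k true (next (S ++ H) k) ∷ S , play-next (S ++ H) k true played′ , refl ∷ sizes , cong suc len

-- Counting squares per bin

same : ℕ → ℕ → ℕ
same b c with b ≟ c
... | yes _ = 1
... | no  _ = 0

same-refl : ∀ b → same b b ≡ 1
same-refl b with b ≟ b
... | yes _ = refl
... | no b≢b = contradiction refl b≢b

occupancy : ℕ → List Entry → ℕ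
occupancy b [] = 0
occupancy b (e ∷ S) = same b (entry-bin e) + occupancy b S

∈⇒occupancy>0 : ∀ {b S} → b ∈ map entry-bin S → 0 < occupancy b S
∈⇒occupancy>0 {b} {e ∷ S} (here refl) = ≤-trans (≤-reflexive (sym (same-refl b))) (m≤m+n _ _)
∈⇒occupancy>0 {b} {e ∷ S} (there b∈) = ≤-trans (∈⇒occupancy>0 b∈) (m≤n+m _ _)

occupancy>0⇒∈ : ∀ {b S} → 0 < occupancy b S → b ∈ map entry-bin S
occupancy>0⇒∈ {b} {e ∷ S} pos-occ with b ≟ entry-bin e
... | yes eq = here eq
... | no _ = there (occupancy>0⇒∈ pos-occ)

sum-map-+ : ∀ (f g : ℕ → ℕ) B → sum (map (λ b → f b + g b) B) ≡ sum (map f B) + sum (map g B)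
sum-map-+ f g [] = refl
sum-map-+ f g (b ∷ B) rewrite sum-map-+ f g B = solve 4 (λ x y u v →
  x :+ y :+ (u :+ v) := x :+ u :+ (y :+ v)) refl (f b) (g b) (sum (map f B)) (sum (map g B))
  where
  open +-*-Solver

sum-map-* : ∀ c (f : ℕ → ℕ) B → sum (map (λ b → c * f b) B) ≡ c * sum (map f B)
sum-map-* c f [] = sym (*-zeroʳ c)
sum-map-* c f (b ∷ B) rewrite sum-map-* c f B = sym (*-distribˡ-+ c (f b) (sum (map f B)))

sum-map-≤ : ∀ (f g : ℕ → ℕ) B → (∀ b → b ∈ B → f b ≤ g b) → sum (map f B) ≤ sum (map g B)
sum-map-≤ f g [] _ = z≤n
sum-map-≤ f g (b ∷ B) le = +-mono-≤ (le b (here refl)) (sum-map-≤ f g B (λ c c∈ → le c (there c∈)))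

⟦_⟧ : Bool → ℕ
⟦ true ⟧ = 1
⟦ false ⟧ = 0

binsWhere : (ℕ → Bool) → List ℕ → List ℕ
binsWhere P = filter (λ b → T? (P b))

sum-⟦⟧ : ∀ P B → sum (map (λ b → ⟦ P b ⟧) B) ≡ length (binsWhere P B)
sum-⟦⟧ P [] = refl
sum-⟦⟧ P (b ∷ B) with P b
... | true = cong suc (sum-⟦⟧ P B)
... | false = sum-⟦⟧ P B

length≤occupancies : ∀ {B S} → All (λ e → entry-bin e ∈ B) S → length S ≤ sum (map (λ b → occupancy b S) B)
length≤occupancies [] = z≤n
length≤occupancies {B} {e ∷ S} (e∈ ∷ es) = begin
  1 + length S                                                         ≤⟨ +-mono-≤ (one e∈) (length≤occupancies es) ⟩
  sum (map (λ b → same b (entry-bin e)) B) + sum (map (λ b → occupancy b S) B)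
                                                                       ≡⟨ sum-map-+ _ _ B ⟨
  sum (map (λ b → occupancy b (e ∷ S)) B)                              ∎
  where
  open ≤-Reasoning
  one : ∀ {c B} → c ∈ B → 1 ≤ sum (map (λ b → same b c) B)
  one {c} (here refl) = ≤-trans (≤-reflexive (sym (same-refl c))) (m≤m+n _ _)
  one {B = b ∷ B} (there c∈) = ≤-trans (one c∈) (m≤n+m _ _)

goodCount : List Entry → ℕ
goodCount [] = 0
goodCount (e ∷ S) = ⟦ isGood e ⟧ + goodCount S

good+bad : ∀ S → goodCount S + length (badBins S) ≡ length S
good+bad [] = refl
good+bad (e ∷ S) with isGood e
... | true = cong suc (good+bad S)
... | false = trans (+-suc (goodCount S) _) (cong suc (good+bad S))

∈-badBins⁻ : ∀ {b} S → b ∈ badBins S → ∃[ e ] ((e ∈ S) × (isGood e ≡ false) × (entry-bin e ≡ b))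
∈-badBins⁻ (e ∷ S) b∈ with isGood e in eq
∈-badBins⁻ (e ∷ S) b∈ | true with e′ , e∈ , r ← ∈-badBins⁻ S b∈ = e′ , there e∈ , r
∈-badBins⁻ (e ∷ S) (here refl) | false = e , here refl , eq , refl
∈-badBins⁻ (e ∷ S) (there b∈) | false with e′ , e∈ , r ← ∈-badBins⁻ S b∈ = e′ , there e∈ , r

AllPairs-++⁻ : ∀ {A : Set} {R : A → A → Set} xs {ys} → AllPairs R (xs ++ ys) →
               AllPairs R xs × All (λ x → All (R x) ys) xs
AllPairs-++⁻ [] _ = [] , []
AllPairs-++⁻ (x ∷ xs) (r ∷ rs) with ps , qs ← AllPairs-++⁻ xs rs =
  Allₚ.++⁻ˡ xs r ∷ ps , Allₚ.++⁻ʳ xs r ∷ qs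

Apart-same-bin : ∀ {D s t} → Inside D s → Inside D t → Apart s t → square-bin s ≡ square-bin t → proj₁ s + proj₁ t ≤ D
Apart-same-bin {D} {k , pos _ c r} {l , pos _ c′ r′} (c≤ , r≤) (c′≤ , r′≤) ap eq = go ap
  where
  beside : ∀ {k l x x′} → x + k ≤ x′ → x′ + l ≤ D → k + l ≤ D
  beside {k} {l} {x} le le′ = ≤-trans (+-monoˡ-≤ l (≤-trans (m≤n+m k x) le)) le′
  go : Apart (k , pos _ c r) (l , pos _ c′ r′) → k + l ≤ D
  go (inj₁ b≢) = contradiction eq b≢
  go (inj₂ (inj₁ le)) = beside le c′≤
  go (inj₂ (inj₂ (inj₁ le))) = subst (_≤ D) (+-comm l k) (beside le c≤)
  go (inj₂ (inj₂ (inj₂ (inj₁ le)))) = beside le r′≤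
  go (inj₂ (inj₂ (inj₂ (inj₂ le)))) = subst (_≤ D) (+-comm l k) (beside le r≤)

-- Capacity bounds for a single bin and the dual weighting

module Weights (d : ℕ) where
  open Scale d

  tagged : List (ℕ × List Entry) → List (ℕ × Entry)
  tagged = concatMap (λ (c , S) → map (c ,_) S)

  untag : ∀ segs → map (roundedEntry d ∘ proj₂) (tagged segs) ≡ map (roundedEntry d) (concatMap proj₂ segs)
  untag [] = refl
  untag ((c , S) ∷ segs) = begin
    map (roundedEntry d ∘ proj₂) (map (c ,_) S ++ tagged segs)                         ≡⟨ map-++ _ (map (c ,_) S) _ ⟩
    map (roundedEntry d ∘ proj₂) (map (c ,_) S) ++ map (roundedEntry d ∘ proj₂) (tagged segs)     ≡⟨ cong₂ _++_ (sym (map-∘ S)) (untag segs) ⟩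
    map (roundedEntry d) S ++ map (roundedEntry d) (concatMap proj₂ segs)                             ≡⟨ map-++ (roundedEntry d) S _ ⟨
    map (roundedEntry d) (S ++ concatMap proj₂ segs)                                     ∎
    where
    open ≡-Reasoning

  -- Shrink each square in bin b to side c in the m-fold subdivision; the shrunk squares still form
  -- a packing, now in side m - 1. The weight c = 0 drops a segment from the estimate.
  weighted-occupancy : ∀ m segs → GridPacking D (map (roundedEntry d) (concatMap proj₂ segs)) →
    All (λ (c , S) → All (λ e → c * D < size e * m) S) segs → ∀ b →
    sum (map (λ (c , S) → c * c * occupancy b S) segs) ≤ (m ∸ 1) * (m ∸ 1)
  weighted-occupancy m segs packing heavy b = begin
    sum (map (λ (c , S) → c * c * occupancy b S) segs)              ≡⟨ sum-segments segs ⟨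
    sum (map (λ (c , _) → c * c) inBin)                             ≡⟨ cong sum (map-∘ {g = area} inBin) ⟩
    sum (map area (map (λ (c , e) → shrink c (roundedEntry d e)) inBin))       ≤⟨ area-bound {B = b ∷ []} shrunk
                                                                        (Allₚ.map⁺ (All.map (λ eq → here (sym eq)) (Allₚ.all-filter here? (tagged segs)))) ⟩
    1 * ((m ∸ 1) * (m ∸ 1))                                         ≡⟨ *-identityˡ _ ⟩
    (m ∸ 1) * (m ∸ 1)                                               ∎
    where
    open ≤-Reasoning
    open Subdivide m D
    here? : (t : ℕ × Entry) → Dec (b ≡ entry-bin (proj₂ t))
    here? (_ , e) = b ≟ entry-bin e
    inBin = filter here? (tagged segs)
    heavy-tagged : ∀ {segs} → All (λ (c , S) → All (λ e → c * D < size e * m) S) segs →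
                   All (λ (c , e) → c * D < size e * m) (tagged segs)
    heavy-tagged [] = []
    heavy-tagged (h ∷ hs) = Allₚ.++⁺ (Allₚ.map⁺ h) (heavy-tagged hs)
    packing-inBin : GridPacking D (map (roundedEntry d ∘ proj₂) inBin)
    packing-inBin with ins , ap ← subst (GridPacking D) (sym (untag segs)) packing =
      Allₚ.map⁺ (Allₚ.filter⁺ here? (Allₚ.map⁻ ins)) , AllPairsₚ.map⁺ (AllPairsₚ.filter⁺ here? (AllPairsₚ.map⁻ ap))
    shrunk : GridPacking (m ∸ 1) (map (λ (c , e) → shrink c (roundedEntry d e)) inBin)
    shrunk = shrink-packing (roundedEntry d ∘ proj₂) proj₁ (Allₚ.filter⁺ here? (heavy-tagged heavy)) packing-inBin
    sum-segment : ∀ c S → sum (map (λ (c , _) → c * c) (filter here? (map (c ,_) S))) ≡ c * c * occupancy b S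
    sum-segment c [] = sym (*-zeroʳ (c * c))
    sum-segment c (e ∷ S) with b ≟ entry-bin e
    ... | yes eq = trans (cong (sum ∘ map (λ (c , _) → c * c)) (filter-accept here? eq))
                  (trans (cong (λ z → c * c + z) (sum-segment c S)) (sym (*-suc (c * c) (occupancy b S))))
    ... | no neq = trans (cong (sum ∘ map (λ (c , _) → c * c)) (filter-reject here? neq)) (sum-segment c S)
    sum-segments : ∀ segs → sum (map (λ (c , _) → c * c) (filter here? (tagged segs))) ≡
                   sum (map (λ (c , S) → c * c * occupancy b S) segs)
    sum-segments [] = refl
    sum-segments ((c , S) ∷ segs)
      rewrite filter-++ here? (map (c ,_) S) (tagged segs)
            | map-++ (λ (c , _) → c * c) (filter here? (map (c ,_) S)) (filter here? (tagged segs))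
            | sum-++ (map (λ (c , _) → c * c) (filter here? (map (c ,_) S))) (map (λ (c , _) → c * c) (filter here? (tagged segs)))
            = cong₂ _+_ (sum-segment c S) (sum-segments segs)

-- s, k and t count the tiny squares, those of side about 1/4 and those of side about 1/3 in a bin.
-- "Closed" bins are those that cannot receive one of the final large squares.
closedQuarter : ℕ → ℕ → Bool
closedQuarter s k = (0 <ᵇ k) ∨ (64 ≤ᵇ s)

badThird : ℕ → ℕ → Bool
badThird k t = (0 <ᵇ t) ∧ (k ≤ᵇ 4)

closedThird : ℕ → ℕ → ℕ → Bool
closedThird s k t = (0 <ᵇ t) ∨ ((6 ≤ᵇ k) ∨ (81 ≤ᵇ s + 9 * k))

-- The coefficients are an integral solution of the linear program dual to the choice of the
-- algorithm's packing, for the ratio 219/125.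
weight : ℕ → ℕ → ℕ → ℕ
weight s k t = 809 * s + 7514 * k + 6095 * t + 1743 * ⟦ 0 <ᵇ k ⟧ + 5620 * ⟦ badThird k t ⟧

-- The coefficients are 125 times 408, 315 and 240, the dual variables of the three stops.
charge : ℕ → ℕ → ℕ → ℕ
charge s k t = 51000 * ⟦ 0 <ᵇ s ⟧ + 39375 * ⟦ closedQuarter s k ⟧ + 30000 * ⟦ closedThird s k t ⟧

-- The hypotheses are the point counts in the 13-, 4- and 3-fold subdivisions. They confine (s , k ,
-- t) to a finite box, in which the inequality is checked by evaluation.
weight≤charge : ∀ s k t → s + 9 * k + 16 * t ≤ 144 → k + t ≤ 9 → t ≤ 4 → weight s k t ≤ charge s k t
weight≤charge s k t area≤ k+t≤9 t≤4 =
  implies (s + 9 * k + 16 * t ≤ᵇ 144) (k + t ≤ᵇ 9) (≤⇒≤ᵇ area≤) (≤⇒≤ᵇ k+t≤9)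
    (use (λ s → implication s k t) s (s≤s (≤-trans (≤-trans (m≤m+n s (9 * k)) (m≤m+n _ (16 * t))) area≤))
      (use (for-all-s t) k (s≤s (≤-trans (m≤m+n k t) k+t≤9))
        (use for-all-k t (s≤s t≤4) verified)))
  where
  implication : ℕ → ℕ → ℕ → Bool
  implication s k t = not ((s + 9 * k + 16 * t ≤ᵇ 144) ∧ (k + t ≤ᵇ 9)) ∨ (weight s k t ≤ᵇ charge s k t)
  for-all-s : ℕ → ℕ → Bool
  for-all-s t k = all (λ s → implication s k t) (upTo 145)
  for-all-k : ℕ → Bool
  for-all-k t = all (for-all-s t) (upTo 10)
  use : ∀ (p : ℕ → Bool) i {n} → i < n → T (all p (upTo n)) → T (p i)
  use p i i<n h = All.lookup (Allₚ.all⁺ p _ h) (∈-upTo⁺ i<n)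
  verified : T (all for-all-k (upTo 5))
  verified = _
  implies : ∀ a b {w c} → T a → T b → T (not (a ∧ b) ∨ (w ≤ᵇ c)) → w ≤ c
  implies true true {w} {c} _ _ h = ≤ᵇ⇒≤ w c h

-- The inequality P (n + f) ≤ R (f + 1 + c + 1) says that a stop fails to give the ratio R / P: n bins are
-- closed to the f large squares, and offline f + 1 + c + 1 bins suffice. Here it is multiplied by m
-- and expressed by the numbers g and b of good and bad squares.
large-squares-bound : ∀ m P R w u v x y z {q n f c g b t} → m * P ≡ q → R ≡ P + w → m * w ≡ x * u → m * R ≡ y * v → y ≡ x + z →
  u * f ≤ g → v * c ≤ b → g + b ≡ t → P * (n + f) ≤ R * ((f + 1) + (c + 1)) →
  q * n ≤ x * t + z * b + m * (2 * R)
large-squares-bound m P R w u v x y z {_} {n} {f} {c} {g} {b} {t} refl refl mw mR refl uf vc refl le =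
  +-cancelʳ-≤ (m * P * f) _ _ (begin
    m * P * n + m * P * f                                    ≡⟨ solve 4 (λ m P n f → m :* P :* n :+ m :* P :* f := m :* (P :* (n :+ f))) refl m P n f ⟩
    m * (P * (n + f))                                        ≤⟨ *-monoʳ-≤ m le ⟩
    m * ((P + w) * ((f + 1) + (c + 1)))                      ≡⟨ solve 5 (λ m P w f c → m :* ((P :+ w) :* ((f :+ con 1) :+ (c :+ con 1)))
                                                                  := m :* w :* f :+ m :* (P :+ w) :* c :+ m :* (con 2 :* (P :+ w)) :+ m :* P :* f) refl m P w f c ⟩
    m * w * f + m * R * c + m * (2 * R) + m * P * f          ≡⟨ cong₂ (λ p q → p * f + q * c + m * (2 * R) + m * P * f) mw mR ⟩
    x * u * f + (x + z) * v * c + m * (2 * R) + m * P * f    ≡⟨ cong₂ (λ p q → p + q + m * (2 * R) + m * P * f) (*-assoc x u f) (*-assoc (x + z) v c) ⟩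
    x * (u * f) + (x + z) * (v * c) + m * (2 * R) + m * P * f
      ≤⟨ +-monoˡ-≤ (m * P * f) (+-monoˡ-≤ (m * (2 * R)) (+-mono-≤ (*-monoʳ-≤ x uf) (*-monoʳ-≤ (x + z) vc))) ⟩
    x * g + (x + z) * b + m * (2 * R) + m * P * f            ≡⟨ cong (λ q → q + m * (2 * R) + m * P * f)
                                                                  (solve 4 (λ x z g b → x :* g :+ (x :+ z) :* b := x :* (g :+ b) :+ z :* b) refl x z g b) ⟩
    x * (g + b) + z * b + m * (2 * R) + m * P * f            ∎)
  where
  open ≤-Reasoning
  open +-*-Solver

-- The surcharges z for bad squares, which the failed stops put on the right, are absorbed on the
-- left: the weights grant the same z to at least as many bins.
combine : ∀ z₁ z₂ {T K₁ K₂ a a′ n₁ n₂ x₁ x₂ c₁ c₂ b₁ b₂} → T + z₁ * K₁ + z₂ * K₂ ≤ a + n₁ + n₂ → a ≤ a′ →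
  n₁ ≤ x₁ + z₁ * b₁ + c₁ → n₂ ≤ x₂ + z₂ * b₂ + c₂ → b₁ ≤ K₁ → b₂ ≤ K₂ → T ≤ a′ + x₁ + x₂ + (c₁ + c₂)
combine z₁ z₂ {T} {K₁} {K₂} {a} {a′} {n₁} {n₂} {x₁} {x₂} {c₁} {c₂} {b₁} {b₂} le a≤ n₁≤ n₂≤ b₁≤ b₂≤ =
  +-cancelʳ-≤ (z₁ * K₁ + z₂ * K₂) T _ (begin
    T + (z₁ * K₁ + z₂ * K₂)                                     ≡⟨ +-assoc T _ _ ⟨
    T + z₁ * K₁ + z₂ * K₂                                       ≤⟨ le ⟩
    a + n₁ + n₂                                                 ≤⟨ +-mono-≤ (+-mono-≤ a≤ n₁≤) n₂≤ ⟩
    a′ + (x₁ + z₁ * b₁ + c₁) + (x₂ + z₂ * b₂ + c₂)              ≤⟨ +-mono-≤ (+-monoʳ-≤ a′ (+-monoˡ-≤ c₁ (+-monoʳ-≤ x₁ (*-monoʳ-≤ z₁ b₁≤))))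
                                                                     (+-monoˡ-≤ c₂ (+-monoʳ-≤ x₂ (*-monoʳ-≤ z₂ b₂≤))) ⟩
    a′ + (x₁ + z₁ * K₁ + c₁) + (x₂ + z₂ * K₂ + c₂)              ≡⟨ solve 7 (λ a x p c y q d → a :+ (x :+ p :+ c) :+ (y :+ q :+ d)
                                                                     := a :+ x :+ y :+ (c :+ d) :+ (p :+ q)) refl a′ x₁ (z₁ * K₁) c₁ x₂ (z₂ * K₂) c₂ ⟩
    a′ + x₁ + x₂ + (c₁ + c₂) + (z₁ * K₁ + z₂ * K₂)              ∎)
  where
  open ≤-Reasoning
  open +-*-Solver

-- 916008 = 809 · 144 + 7514 · 48 + 6095 · 72 exceeds 915048 = 408 · 219 + 5922 · 48 + 7520 · 72.
weights-exceed-charges : ∀ {M} → 254 ≤ M →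
  809 * (144 * M) + 7514 * (48 * M) + 6095 * (72 * M) ≤
  408 * (219 * M) + 5922 * (48 * M) + 7520 * (72 * M) + (315 * (2 * 219) + 240 * (2 * 219)) → ⊥
weights-exceed-charges {M} M≥ le = <⇒≱ (<ᵇ⇒< 243090 (960 * 254) _) (≤-trans (*-monoʳ-≤ 960 M≥)
  (+-cancelˡ-≤ (915048 * M) (960 * M) 243090 (subst₂ _≤_
    (trans (merge 809 144 7514 48 6095 72 refl) (*-distribʳ-+ M 915048 960))
    (cong (_+ 243090) (merge 408 219 5922 48 7520 72 refl)) le)))
  where
  merge : ∀ a a′ b b′ c c′ {q} → a * a′ + b * b′ + c * c′ ≡ q → a * (a′ * M) + b * (b′ * M) + c * (c′ * M) ≡ q * M
  merge a a′ b b′ c c′ refl = solve 7 (λ a a′ b b′ c c′ M → a :* (a′ :* M) :+ b :* (b′ :* M) :+ c :* (c′ :* M)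
    := (a :* a′ :+ b :* b′ :+ c :* c′) :* M) refl a a′ b b′ c c′ M
    where
    open +-*-Solver

scale-≤ : ∀ m {P q n k} → m * P ≡ q → P * n ≤ k → q * n ≤ m * k
scale-≤ m {P} {n = n} refl le = ≤-trans (≤-reflexive (*-assoc m P n)) (*-monoʳ-≤ m le)

-- The sum of the three failed stops with multipliers 408, 315 and 240, set against the weights. The
-- bound 254 is the least M for which the gain 960 M exceeds the rounding loss 243090.
no-algorithm-beats-all-stops : ∀ {M a n₁ n₂ f₁ c₁ g₁ b₁ K₁ f₂ c₂ g₂ b₂ K₂} → 254 ≤ M →
  809 * (144 * M) + 7514 * (48 * M) + 6095 * (72 * M) + 1743 * K₁ + 5620 * K₂ ≤ 51000 * a + 39375 * n₁ + 30000 * n₂ →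
  b₁ ≤ K₁ → 5 * f₁ ≤ g₁ → 9 * c₁ ≤ b₁ → g₁ + b₁ ≡ 48 * M →
  b₂ ≤ K₂ → 3 * f₂ ≤ g₂ → 4 * c₂ ≤ b₂ → g₂ + b₂ ≡ 72 * M →
  125 * a ≤ 219 * M →
  125 * (n₁ + f₁) ≤ 219 * ((f₁ + 1) + (c₁ + 1)) →
  125 * (n₂ + f₂) ≤ 219 * ((f₂ + 1) + (c₂ + 1)) → ⊥
no-algorithm-beats-all-stops {M} {a} {n₁} {n₂} {f₁} {c₁} {g₁} {b₁} {K₁} {f₂} {c₂} {g₂} {b₂} {K₂}
  M≥ total b₁≤ f₁≤ c₁≤ eq₁ b₂≤ f₂≤ c₂≤ eq₂ h₀ h₁ h₂ =
  weights-exceed-charges M≥ (combine 1743 5620 {K₁ = K₁} {K₂} {51000 * a} {408 * (219 * M)} {39375 * n₁} {30000 * n₂}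
    {5922 * (48 * M)} {7520 * (72 * M)} {315 * (2 * 219)} {240 * (2 * 219)} {b₁} {b₂} total first second third b₁≤ b₂≤)
  where
  first : 51000 * a ≤ 408 * (219 * M)
  first = scale-≤ 408 {125} {51000} {a} {219 * M} refl h₀
  second : 39375 * n₁ ≤ 5922 * (48 * M) + 1743 * b₁ + 315 * (2 * 219)
  -- Here 94 = 219 - 125 is the price of an offline bin with a large square, net of the bin that the
  -- algorithm opens for it. Shared by five good squares this gives 5922 = 315 · 94 / 5 each; a bad
  -- square costs 7665 = 315 · 219 / 9, which is 1743 more.
  second = large-squares-bound 315 125 219 94 5 9 5922 7665 1743 {39375} {n₁} {f₁} {c₁} {g₁} {b₁} {48 * M}
             refl refl refl refl refl f₁≤ c₁≤ eq₁ h₁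
  third : 30000 * n₂ ≤ 7520 * (72 * M) + 5620 * b₂ + 240 * (2 * 219)
  -- Likewise 7520 = 240 · 94 / 3 and 13140 = 240 · 219 / 4, with difference 5620.
  third = large-squares-bound 240 125 219 94 3 4 7520 13140 5620 {30000} {n₂} {f₂} {c₂} {g₂} {b₂} {72 * M}
             refl refl refl refl refl f₂≤ c₂≤ eq₂ h₂

sum-linear : ∀ p q r (f g h : ℕ → ℕ) B → sum (map (λ b → p * f b + q * g b + r * h b) B) ≡
             p * sum (map f B) + q * sum (map g B) + r * sum (map h B)
sum-linear p q r f g h B = trans (sum-map-+ (λ b → p * f b + q * g b) (λ b → r * h b) B)
  (cong₂ _+_ (trans (sum-map-+ (λ b → p * f b) (λ b → q * g b) B) (cong₂ _+_ (sum-map-* p f B) (sum-map-* q g B)))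
             (sum-map-* r h B))

sum-linear₅ : ∀ p q r u v (f g h i j : ℕ → ℕ) B →
  sum (map (λ b → p * f b + q * g b + r * h b + u * i b + v * j b) B) ≡
  p * sum (map f B) + q * sum (map g B) + r * sum (map h B) + u * sum (map i B) + v * sum (map j B)
sum-linear₅ p q r u v f g h i j B =
  trans (sum-map-+ (λ b → p * f b + q * g b + r * h b + u * i b) (λ b → v * j b) B)
  (cong₂ _+_ (trans (sum-map-+ (λ b → p * f b + q * g b + r * h b) (λ b → u * i b) B)
    (cong₂ _+_ (sum-linear p q r f g h B) (sum-map-* u i B))) (sum-map-* v j B))

double-count : ∀ p q r u v x y z (f g h : ℕ → ℕ) (F G X Y Z : ℕ → Bool) B {n₁ n₂ n₃} →
  n₁ ≤ sum (map f B) → n₂ ≤ sum (map g B) → n₃ ≤ sum (map h B) →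
  (∀ b → p * f b + q * g b + r * h b + u * ⟦ F b ⟧ + v * ⟦ G b ⟧ ≤ x * ⟦ X b ⟧ + y * ⟦ Y b ⟧ + z * ⟦ Z b ⟧) →
  p * n₁ + q * n₂ + r * n₃ + u * length (binsWhere F B) + v * length (binsWhere G B) ≤
  x * length (binsWhere X B) + y * length (binsWhere Y B) + z * length (binsWhere Z B)
double-count p q r u v x y z f g h F G X Y Z B {n₁} {n₂} {n₃} n₁≤ n₂≤ n₃≤ le
  rewrite sym (sum-⟦⟧ F B) | sym (sum-⟦⟧ G B) | sym (sum-⟦⟧ X B) | sym (sum-⟦⟧ Y B) | sym (sum-⟦⟧ Z B) = begin
    p * n₁ + q * n₂ + r * n₃ + u * #F + v * #G
      ≤⟨ +-monoˡ-≤ (v * #G) (+-monoˡ-≤ (u * #F) (+-mono-≤ (+-mono-≤ (*-monoʳ-≤ p n₁≤) (*-monoʳ-≤ q n₂≤)) (*-monoʳ-≤ r n₃≤))) ⟩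
    p * sum (map f B) + q * sum (map g B) + r * sum (map h B) + u * #F + v * #G
      ≡⟨ sum-linear₅ p q r u v f g h (λ b → ⟦ F b ⟧) (λ b → ⟦ G b ⟧) B ⟨
    sum (map (λ b → p * f b + q * g b + r * h b + u * ⟦ F b ⟧ + v * ⟦ G b ⟧) B)
      ≤⟨ sum-map-≤ _ _ B (λ b _ → le b) ⟩
    sum (map (λ b → x * ⟦ X b ⟧ + y * ⟦ Y b ⟧ + z * ⟦ Z b ⟧) B)
      ≡⟨ sum-linear x y z (λ b → ⟦ X b ⟧) (λ b → ⟦ Y b ⟧) (λ b → ⟦ Z b ⟧) B ⟩
    x * sum (map (λ b → ⟦ X b ⟧) B) + y * sum (map (λ b → ⟦ Y b ⟧) B) + z * sum (map (λ b → ⟦ Z b ⟧) B) ∎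
  where
  open ≤-Reasoning
  #F = sum (map (λ b → ⟦ F b ⟧) B)
  #G = sum (map (λ b → ⟦ G b ⟧) B)

≤-roundUp : ∀ g n .{{_ : NonZero n}} → g ≤ (g / n + 1) * n
≤-roundUp g n = begin
  g                       ≡⟨ m≡m%n+[m/n]*n g n ⟩
  g % n + g / n * n       ≤⟨ +-monoˡ-≤ (g / n * n) (<⇒≤ (m%n<n g n)) ⟩
  n + g / n * n           ≡⟨ cong (_* n) (+-comm 1 (g / n)) ⟩
  (g / n + 1) * n         ∎
  where
  open ≤-Reasoning

roundDown-≤ : ∀ g n .{{_ : NonZero n}} → n * (g / n) ≤ g
roundDown-≤ g n = ≤-trans (≤-reflexive (*-comm n (g / n))) (m/n*n≤m g n)

ratio-≤ : ∀ P R p E Q L .{{_ : NonZero P}} → p * P ≤ R * E → R * Q ≤ P * L → p * Q ≤ L * E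
ratio-≤ P R p E Q L pP≤ RQ≤ = *-cancelˡ-≤ P (begin
  P * (p * Q)      ≡⟨ solve 3 (λ P p Q → P :* (p :* Q) := p :* P :* Q) refl P p Q ⟩
  p * P * Q        ≤⟨ *-monoˡ-≤ Q pP≤ ⟩
  R * E * Q        ≡⟨ solve 3 (λ R E Q → R :* E :* Q := E :* (R :* Q)) refl R E Q ⟩
  E * (R * Q)      ≤⟨ *-monoʳ-≤ E RQ≤ ⟩
  E * (P * L)      ≡⟨ solve 3 (λ E P L → E :* (P :* L) := P :* (L :* E)) refl E P L ⟩
  P * (L * E)      ∎)
  where
  open ≤-Reasoning
  open +-*-Solver

-- Roles of the squares played and conflicts with large squares

role-entries : Role → List Entry → List (Role × ℕ)
role-entries ρ = map (λ e → ρ , size e)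

adaptive-role : Entry → Role × ℕ
adaptive-role e = (if isGood e then good else bad) , size e

count-role-entries : ∀ ρ σ S → count ρ (role-entries σ S) ≡ tally ρ σ * length S
count-role-entries ρ σ [] = sym (*-zeroʳ (tally ρ σ))
count-role-entries ρ σ (e ∷ S) = trans (cong (tally ρ σ +_) (count-role-entries ρ σ S)) (sym (*-suc (tally ρ σ) (length S)))

count-adaptive : ∀ ρ S → count ρ (map adaptive-role S) ≡ tally ρ good * goodCount S + tally ρ bad * length (badBins S)
count-adaptive ρ [] = sym (cong₂ _+_ (*-zeroʳ (tally ρ good)) (*-zeroʳ (tally ρ bad)))
count-adaptive ρ (e ∷ S) with isGood e
... | true = trans (cong (tally ρ good +_) (count-adaptive ρ S))
  (solve 4 (λ x y g b → x :+ (x :* g :+ y :* b) := x :* (con 1 :+ g) :+ y :* b) refl (tally ρ good) (tally ρ bad) (goodCount S) (length (badBins S)))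
  where
  open +-*-Solver
... | false = trans (cong (tally ρ bad +_) (count-adaptive ρ S))
  (solve 4 (λ x y g b → y :+ (x :* g :+ y :* b) := x :* g :+ y :* (con 1 :+ b)) refl (tally ρ good) (tally ρ bad) (goodCount S) (length (badBins S)))
  where
  open +-*-Solver

large-bins-distinct : ∀ {d k S} → suc d < k + k → All (λ e → size e ≡ k) S → GridPacking (suc d) (map (roundedEntry d) S) →
                      Unique (map entry-bin S)
large-bins-distinct _ [] _ = []
large-bins-distinct {d} {S = e ∷ S} D< (refl ∷ sizes) (i ∷ is , a ∷ as) = go sizes is a ∷ large-bins-distinct D< sizes (is , as)
  where
  go : ∀ {S} → All (λ e′ → size e′ ≡ size e) S → All (Inside (suc d)) (map (roundedEntry d) S) →
       All (Apart (roundedEntry d e)) (map (roundedEntry d) S) → All (entry-bin e ≢_) (map entry-bin S)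
  go [] [] [] = []
  go {e′ ∷ S} (eq ∷ eqs) (i′ ∷ is) (a ∷ as) =
    (λ same-bin → <⇒≱ D< (subst (λ l → size e + l ≤ suc d) eq (Apart-same-bin {s = roundedEntry d e} {t = roundedEntry d e′} i i′ a same-bin)))
    ∷ go eqs is as

conflict-free : ∀ {d} S {S′} → GridPacking (suc d) (map (roundedEntry d) (S ++ S′)) →
  All (λ e → All (λ e′ → entry-bin e ≡ entry-bin e′ → size e + size e′ ≤ suc d) S′) S
conflict-free [] _ = []
conflict-free {d} (e ∷ S) (i ∷ is , a ∷ as) =
  Allₚ.++⁻ʳ S (go (S ++ _) is a) ∷ conflict-free S (is , as)
  where
  go : ∀ T → All (Inside (suc d)) (map (roundedEntry d) T) → All (Apart (roundedEntry d e)) (map (roundedEntry d) T) →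
       All (λ e′ → entry-bin e ≡ entry-bin e′ → size e + size e′ ≤ suc d) T
  go [] _ _ = []
  go (t ∷ T) (j ∷ js) (b ∷ bs) = Apart-same-bin {s = roundedEntry d e} {t = roundedEntry d t} i j b ∷ go T js bs

-- The game

-- The numbers 72 M, 48 M and 144 M of 1/3-, 1/4- and tiny squares are in the proportion 3 : 2 : 6
-- of a bin of `Third.largeBins`, and 144 M tiny squares fill the slots of M grid bins exactly.
module Adversary (A : OnlineAlg) (ε : ℚ) (0<ε : 0ℚ ℚ.< ε) (Q₀ M U d p e : ℕ) (M≥ : 254 ≤ M) (Q₀≤M : Q₀ ≤ M)
                 (U≡ : U ≡ 2 ^ (48 * M + 72 * M)) (D≡ : suc d ≡ 480 * U) (p≤ : p * 125 ≤ 219 * suc e) where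

  open Scale d using (D)
  open Play A d
  open Weights d

  r : ℚ
  r = (ℤ.+ p) ℚ./ suc e

  0<U : 0 < U
  0<U = subst (0 <_) (sym U≡) (m^n>0 2 (48 * M + 72 * M))

  0<M : 0 < M
  0<M = ≤-trans (s≤s z≤n) M≥

  ≤D : ∀ {a k} → a ≤ 480 → k ≤ a * U → k ≤ D
  ≤D a≤ k≤ = ≤-trans k≤ (≤-trans (*-monoˡ-≤ U a≤) (≤-reflexive (sym D≡)))

  valid-size : ∀ a b {k} → 0 < a → a * U ≤ k → b ≤ 480 → k ≤ b * U → (0 < k) × (k ≤ D)
  valid-size a b 0<a lo hi-bound hi = ≤-trans (*-mono-≤ 0<a 0<U) lo , ≤D hi-bound hi

  heavy : ∀ c m a {k} → c * 480 < a * m → a * U ≤ k → c * D < k * m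
  heavy c m a {k} c< le = begin-strict
    c * D           ≡⟨ cong (c *_) D≡ ⟩
    c * (480 * U)   ≡⟨ *-assoc c 480 U ⟨
    c * 480 * U     <⟨ *-monoˡ-< U {{>-nonZero 0<U}} c< ⟩
    a * m * U       ≡⟨ solve 3 (λ a m U → a :* m :* U := a :* U :* m) refl a m U ⟩
    a * U * m       ≤⟨ *-monoˡ-≤ m le ⟩
    k * m           ∎
    where
    open ≤-Reasoning
    open +-*-Solver

  -- Needed since 120 · 4 = 480 and 160 · 3 = 480 leave no slack: strictness has to come from the
  -- positive excess. For tiny squares 37 · 13 = 481 is already strict.
  heavy′ : ∀ c m a {k} .{{_ : NonZero m}} → c * 480 ≤ a * m → a * U < k → c * D < k * m
  heavy′ c m a {k} c≤ lt = begin-strict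
    c * D           ≡⟨ cong (c *_) D≡ ⟩
    c * (480 * U)   ≡⟨ *-assoc c 480 U ⟨
    c * 480 * U     ≤⟨ *-monoˡ-≤ U c≤ ⟩
    a * m * U       ≡⟨ solve 3 (λ a m U → a :* m :* U := a :* U :* m) refl a m U ⟩
    a * U * m       <⟨ *-monoˡ-< m lt ⟩
    k * m           ∎
    where
    open ≤-Reasoning
    open +-*-Solver

  heavies : ∀ c m a {S} → T (c * 480 <ᵇ a * m) → All (λ e → a * U ≤ size e) S → All (λ e → c * D < size e * m) S
  heavies c m a t = All.map (heavy c m a (<ᵇ⇒< _ _ t))

  heavies′ : ∀ c m a {S} .{{_ : NonZero m}} → T (c * 480 ≤ᵇ a * m) → All (λ e → a * U < size e) S → All (λ e → c * D < size e * m) S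
  heavies′ c m a t = All.map (heavy′ c m a (≤ᵇ⇒≤ _ _ t))

  bisected-sizes : ∀ {base open? H S lo hi} → lo < hi → Bisected base U open? H S lo hi →
                   All (λ e → (base < size e) × (size e ≤ base + U)) S
  bisected-sizes {base} {lo = lo} {hi} lo<hi s = All.zipWith (λ {e} → go {e}) (goods s , bads s)
    where
    go : ∀ {e} → (isGood e ≡ true → (base < size e) × (size e ≤ base + lo)) ×
                 (isGood e ≡ false → (base + hi ≤ size e) × (size e ≤ base + U)) → (base < size e) × (size e ≤ base + U)
    go {e} (g , b) with isGood e
    ... | true = proj₁ (g refl) , ≤-trans (proj₂ (g refl)) (+-monoʳ-≤ base (≤-trans (<⇒≤ lo<hi) (hi≤U s)))
    ... | false = <-≤-trans (m<m+n base (≤-<-trans z≤n lo<hi)) (proj₁ (b refl)) , proj₂ (b refl)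

  -- With five squares of side about 1/4, a square of side about 1/3 already excludes a large one:
  -- together they would meet 5 + 1 + 4 of the 3 × 3 inner points of the 4 × 4 subdivision.
  fewQuarters : List Entry → ℕ → Bool
  fewQuarters S b = occupancy b S ≤ᵇ 4

  to-D : ∀ {g h E} → g + h ≡ U → GridPacking (480 * (g + h)) E → GridPacking D E
  to-D {E = E} eq = subst (λ m → GridPacking m E) (trans (cong (480 *_) eq) (sym D≡))

  adaptive-caps : ∀ {base open? H S lo hi} (cap : Role → ℕ) → base + lo ≤ cap good → base + U ≤ cap bad →
    Bisected base U open? H S lo hi → All (λ (ρ , k) → k ≤ cap ρ) (map adaptive-role S)
  adaptive-caps {base} {S = S} {lo} {hi} cap good≤ bad≤ s = Allₚ.map⁺ (All.zipWith (λ {e} → go {e}) (goods s , bads s))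
    where
    go : ∀ {e} → (isGood e ≡ true → (base < size e) × (size e ≤ base + lo)) ×
                 (isGood e ≡ false → (base + hi ≤ size e) × (size e ≤ base + U)) →
                 size e ≤ cap (proj₁ (adaptive-role e))
    go {e} (g , b) with isGood e
    ... | true = ≤-trans (proj₂ (g refl)) good≤
    ... | false = ≤-trans (proj₂ (b refl)) bad≤

  large-avoids-bad : ∀ {SX S H K m b} → GridPacking D (map (roundedEntry d) (SX ++ (S ++ H))) →
    All (λ e → size e ≡ K) SX → All (λ e → isGood e ≡ false → m ≤ size e) S → D < K + m →
    b ∈ map entry-bin SX → b ∉ badBins S
  large-avoids-bad {SX} {S} {H} {K} {m} packing sizes bad≥ D< b∈X b∈bad
    with x , x∈ , refl ← ∈-map⁻ entry-bin b∈X
    with y , y∈ , y-bad , same-bin ← ∈-badBins⁻ S b∈bad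
    = <⇒≱ D< (≤-trans (+-mono-≤ (≤-reflexive (sym (All.lookup sizes x∈))) (All.lookup bad≥ y∈ y-bad))
        (All.lookup (Allₚ.++⁻ˡ S (All.lookup (conflict-free SX packing) x∈)) y∈ (sym same-bin)))

  -- The large squares lie in pairwise distinct bins, because two of them exceed D, and in none of
  -- the bins of `W`. The algorithm has therefore opened at least `length W + f` bins.
  finish : ∀ {H SX W E} K f Q → Played (SX ++ H) → All ValidSize (SX ++ H) → GridPacking D (map (roundedEntry d) (SX ++ H)) →
    All (λ e → size e ≡ K) SX → length SX ≡ f → D < K + K →
    Unique W → W ⊆ map entry-bin H → (∀ {b} → b ∈ W → b ∉ map entry-bin SX) →
    map proj₁ E ≡ map size (SX ++ H) → GridPacking D E → All (λ s → square-bin s < Q) E → M ≤ Q →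
    219 * Q ≤ 125 * (length W + f) → Outcome r ε Q₀
  finish {H} {SX} {W} {E} K f Q playedX valid-sizes packing sizes len D< uW W⊆ disjoint E≡ E-packing E-bins M≤Q ratio =
    stop-history p e ε Q₀ Q (SX ++ H) E (W ++ map entry-bin SX) 0<ε (≤-trans Q₀≤M M≤Q) (≤-trans 0<M M≤Q)
      playedX valid-sizes E≡ E-packing E-bins
      (Uniqueₚ.++⁺ uW (large-bins-distinct D< sizes packingX) (λ (b∈W , b∈X) → disjoint b∈W b∈X))
      L⊆ (ratio-≤ 125 219 p (suc e) Q (length (W ++ map entry-bin SX)) p≤ (subst (λ n → 219 * Q ≤ 125 * n) (sym length-L) ratio))
    where
    packingX : GridPacking D (map (roundedEntry d) SX)
    packingX with ins , ap ← subst (GridPacking D) (map-++ (roundedEntry d) SX H) packing =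
      Allₚ.++⁻ˡ (map (roundedEntry d) SX) ins , proj₁ (AllPairs-++⁻ (map (roundedEntry d) SX) ap)
    L⊆ : (W ++ map entry-bin SX) ⊆ map entry-bin (SX ++ H)
    L⊆ {b} b∈ = subst (b ∈_) (sym (map-++ entry-bin SX H)) (side (∈-++⁻ W b∈))
      where
      side : b ∈ W ⊎ b ∈ map entry-bin SX → b ∈ map entry-bin SX ++ map entry-bin H
      side (inj₁ b∈W) = ∈-++⁺ʳ (map entry-bin SX) (W⊆ b∈W)
      side (inj₂ b∈X) = ∈-++⁺ˡ b∈X
    length-L : length (W ++ map entry-bin SX) ≡ length W + f
    length-L = trans (length-++ W) (cong (λ n → length W + n) (trans (length-map entry-bin SX) len))

  module Large (a base γ hi : ℕ) (a+base : suc a + base ≡ 480) (240≤a : 240 < a) (γ<hi : γ < hi) (hi≤U : hi ≤ U) where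

    slack : ℕ
    slack = U ∸ γ

    split : γ + slack ≡ U
    split = m+[n∸m]≡n (≤-trans (<⇒≤ γ<hi) hi≤U)

    -- This is (a + 1) U - γ, that is, D minus the largest side `base * U + γ` of a good square, in
    -- the slope form of `cap big`.
    K : ℕ
    K = a * γ + suc a * slack

    lower-K : a * U ≤ K
    lower-K = begin
      a * U                    ≡⟨ cong (a *_) split ⟨
      a * (γ + slack)          ≡⟨ *-distribˡ-+ a γ slack ⟩
      a * γ + a * slack        ≤⟨ +-monoʳ-≤ (a * γ) (*-monoˡ-≤ slack (n≤1+n a)) ⟩
      K                        ∎
      where
      open ≤-Reasoning

    upper-K : K ≤ suc a * U
    upper-K = begin
      K                                ≤⟨ +-monoˡ-≤ (suc a * slack) (*-monoˡ-≤ γ (n≤1+n a)) ⟩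
      suc a * γ + suc a * slack        ≡⟨ *-distribˡ-+ (suc a) γ slack ⟨
      suc a * (γ + slack)              ≡⟨ cong (suc a *_) split ⟩
      suc a * U                        ∎
      where
      open ≤-Reasoning

    large-valid : (0 < K) × (K ≤ D)
    large-valid = valid-size a (suc a) (≤-<-trans z≤n 240≤a) lower-K (subst (suc a ≤_) a+base (m≤m+n (suc a) base)) upper-K

    two-large : D < K + K
    two-large = begin-strict
      D                ≡⟨ D≡ ⟩
      (240 + 240) * U  <⟨ *-monoˡ-< U {{>-nonZero 0<U}} (+-mono-< 240≤a 240≤a) ⟩
      (a + a) * U      ≡⟨ *-distribʳ-+ U a a ⟩
      a * U + a * U    ≤⟨ +-mono-≤ lower-K lower-K ⟩
      K + K            ∎
      where
      open ≤-Reasoning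

    -- K leaves room for an excess of exactly γ, and `hi` is at least γ + 1.
    large-and-bad : D < K + (base * U + hi)
    large-and-bad = begin-strict
      D                                                  ≡⟨ trans D≡ (cong₂ _*_ (sym a+base) (sym split)) ⟩
      (suc a + base) * (γ + slack)                       <⟨ n<1+n _ ⟩
      suc ((suc a + base) * (γ + slack))                 ≡⟨ solve 4 (λ a b g h → con 1 :+ (con 1 :+ a :+ b) :* (g :+ h)
                                                              := a :* g :+ (con 1 :+ a) :* h :+ (b :* (g :+ h) :+ (con 1 :+ g))) refl a base γ slack ⟩
      K + (base * (γ + slack) + suc γ)                   ≤⟨ +-monoʳ-≤ K (+-mono-≤ (≤-reflexive (cong (base *_) split)) γ<hi) ⟩
      K + (base * U + hi)                                ∎
      where
      open ≤-Reasoning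
      open +-*-Solver

    tiny-cap : ∀ n → n * U ≡ n * γ + n * slack
    tiny-cap n = trans (cong (n *_) (sym split)) (*-distribˡ-+ n γ slack)

    good-cap : ∀ n → n * U + γ ≡ suc n * γ + n * slack
    good-cap n = trans (cong (_+ γ) (tiny-cap n)) (solve 3 (λ n g h → n :* g :+ n :* h :+ g := (con 1 :+ n) :* g :+ n :* h) refl n γ slack)
      where
      open +-*-Solver

    bad-cap : ∀ n → n * U + U ≡ suc n * γ + suc n * slack
    bad-cap n = trans (+-comm (n * U) U) (tiny-cap (suc n))

  start : ∀ base open? {H} n r → 2 ^ (n + r) ≡ U → Played H → Bisected base U open? H [] 0 (2 ^ (n + r))
  start base open? n r eq played = record
    { played = played ; hi≤U = ≤-reflexive eq ; goods = [] ; bads = []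
    ; bad-open = [] ; bad-unique = [] ; blocked = [] }

  module Run (S₀ S₁ S₂ : List Entry) (γ₁ hi₁ γ₂ hi₂ : ℕ) (γ₁<hi₁ : γ₁ < hi₁) (γ₂<hi₂ : γ₂ < hi₂)
      (played₀ : Played (S₀ ++ [])) (sizes₀ : All (λ e → size e ≡ 37 * U) S₀)
      (bisected₁ : Bisected (120 * U) U (λ _ → true) (S₀ ++ []) S₁ γ₁ hi₁)
      (bisected₂ : Bisected (160 * U) U (fewQuarters S₁) (S₁ ++ S₀ ++ []) S₂ γ₂ hi₂)
      (length₀ : length S₀ ≡ 144 * M) (length₁ : length S₁ ≡ 48 * M) (length₂ : length S₂ ≡ 72 * M) where

    H₀ H₁ H₂ : List Entry
    H₀ = S₀ ++ []
    H₁ = S₁ ++ H₀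
    H₂ = S₂ ++ H₁

    ranges₁ : All (λ e → (120 * U < size e) × (size e ≤ 120 * U + U)) S₁
    ranges₁ = bisected-sizes γ₁<hi₁ bisected₁

    ranges₂ : All (λ e → (160 * U < size e) × (size e ≤ 160 * U + U)) S₂
    ranges₂ = bisected-sizes γ₂<hi₂ bisected₂

    lower₀ : All (λ e → 37 * U ≤ size e) S₀
    lower₀ = All.map (≤-reflexive ∘ sym) sizes₀

    lower₁ : All (λ e → 120 * U < size e) S₁
    lower₁ = All.map proj₁ ranges₁

    lower₂ : All (λ e → 160 * U < size e) S₂
    lower₂ = All.map proj₁ ranges₂

    1+-* : ∀ a → a * U + U ≡ suc a * U
    1+-* a = +-comm (a * U) U

    valid₀ : All ValidSize H₀
    valid₀ = Allₚ.++⁺ (All.map (λ eq → valid-size 37 37 (s≤s z≤n) (≤-reflexive (sym eq)) (≤ᵇ⇒≤ 37 480 _) (≤-reflexive eq)) sizes₀) []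

    valid₁ : All ValidSize H₁
    valid₁ = Allₚ.++⁺ (All.map (λ (lo , hi) → valid-size 120 121 (s≤s z≤n) (<⇒≤ lo) (≤ᵇ⇒≤ 121 480 _) (≤-trans hi (≤-reflexive (1+-* 120)))) ranges₁) valid₀

    valid₂ : All ValidSize H₂
    valid₂ = Allₚ.++⁺ (All.map (λ (lo , hi) → valid-size 160 161 (s≤s z≤n) (<⇒≤ lo) (≤ᵇ⇒≤ 161 480 _) (≤-trans hi (≤-reflexive (1+-* 160)))) ranges₂) valid₁

    packing₂ : GridPacking D (map (roundedEntry d) H₂)
    packing₂ = played-packing (played bisected₂) valid₂

    tinies quarters thirds : ℕ → ℕ
    tinies b = occupancy b S₀
    quarters b = occupancy b S₁
    thirds b = occupancy b S₂

    bin-weight≤charge : ∀ b → weight (tinies b) (quarters b) (thirds b) ≤ charge (tinies b) (quarters b) (thirds b)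
    bin-weight≤charge b = weight≤charge (tinies b) (quarters b) (thirds b)
      (subst (_≤ 144) (solve 3 (λ s k t → con 16 :* t :+ (con 9 :* k :+ (con 1 :* s :+ con 0)) := s :+ con 9 :* k :+ con 16 :* t) refl
          (tinies b) (quarters b) (thirds b))
        -- Sides above 1/3, 1/4 and 1/13 exceed 4/13, 3/13 and 1/13, which gives the weights 16, 9
        -- and 1 among 144 points.
        (weighted-occupancy 13 ((4 , S₂) ∷ (3 , S₁) ∷ (1 , S₀) ∷ []) packing₂
          (heavies′ 4 13 160 _ lower₂ ∷ heavies′ 3 13 120 _ lower₁ ∷ heavies 1 13 37 _ lower₀ ∷ []) b))
      (subst (_≤ 9) (solve 2 (λ k t → con 1 :* t :+ (con 1 :* k :+ con 0) := k :+ t) refl (quarters b) (thirds b))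
        (weighted-occupancy 4 ((1 , S₂) ∷ (1 , S₁) ∷ (0 , S₀) ∷ []) packing₂
          (heavies′ 1 4 160 _ lower₂ ∷ heavies′ 1 4 120 _ lower₁ ∷ heavies 0 4 37 _ lower₀ ∷ []) b))
      (subst (_≤ 4) (solve 1 (λ t → con 1 :* t :+ con 0 := t) refl (thirds b))
        (weighted-occupancy 3 ((1 , S₂) ∷ (0 , S₁) ∷ (0 , S₀) ∷ []) packing₂
          (heavies′ 1 3 160 _ lower₂ ∷ heavies′ 0 3 120 _ lower₁ ∷ heavies 0 3 37 _ lower₀ ∷ []) b))
      where
      open +-*-Solver

    B : List ℕ
    B = deduplicate _≟_ (map entry-bin H₂)

    B-Unique : Unique B
    B-Unique = deduplicate-! (map entry-bin H₂)

    ∈B : ∀ {e} → e ∈ H₂ → entry-bin e ∈ B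
    ∈B e∈ = ∈-deduplicate⁺ _≟_ (∈-map⁺ entry-bin e∈)

    -- All three are taken from the bins of the full history, so that one sum over `B` compares
    -- them. Their conditions mention only squares of phases before the respective stop, so these
    -- bins are occupied by then.
    where₀ where₁ where₂ : List ℕ
    where₀ = binsWhere (λ b → 0 <ᵇ tinies b) B
    where₁ = binsWhere (λ b → closedQuarter (tinies b) (quarters b)) B
    where₂ = binsWhere (λ b → closedThird (tinies b) (quarters b) (thirds b)) B

    K₁ K₂ : ℕ
    K₁ = length (binsWhere (λ b → 0 <ᵇ quarters b) B)
    K₂ = length (binsWhere (λ b → badThird (quarters b) (thirds b)) B)

    total : 809 * (144 * M) + 7514 * (48 * M) + 6095 * (72 * M) + 1743 * K₁ + 5620 * K₂ ≤
            51000 * length where₀ + 39375 * length where₁ + 30000 * length where₂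
    total = double-count 809 7514 6095 1743 5620 51000 39375 30000 tinies quarters thirds
      (λ b → 0 <ᵇ quarters b) (λ b → badThird (quarters b) (thirds b)) (λ b → 0 <ᵇ tinies b)
      (λ b → closedQuarter (tinies b) (quarters b)) (λ b → closedThird (tinies b) (quarters b) (thirds b)) B
      (covered-length S₀ length₀ (All.tabulate λ e∈ → ∈B (∈-++⁺ʳ S₂ (∈-++⁺ʳ S₁ (∈-++⁺ˡ e∈)))))
      (covered-length S₁ length₁ (All.tabulate λ e∈ → ∈B (∈-++⁺ʳ S₂ (∈-++⁺ˡ e∈))))
      (covered-length S₂ length₂ (All.tabulate λ e∈ → ∈B (∈-++⁺ˡ e∈)))
      bin-weight≤charge
      where
      covered-length : ∀ S {n} → length S ≡ n → All (λ e → entry-bin e ∈ B) S → n ≤ sum (map (λ b → occupancy b S) B)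
      covered-length S refl cov = length≤occupancies cov

    ∈-binsWhere⁺ : ∀ (P : ℕ → Bool) {b} → b ∈ B → T (P b) → b ∈ binsWhere P B
    ∈-binsWhere⁺ P = ∈-filter⁺ (λ b → T? (P b))

    ∈-binsWhere⁻ : ∀ (P : ℕ → Bool) {b} → b ∈ binsWhere P B → b ∈ B × T (P b)
    ∈-binsWhere⁻ P = ∈-filter⁻ (λ b → T? (P b)) {xs = B}

    binsWhere-Unique : ∀ (P : ℕ → Bool) → Unique (binsWhere P B)
    binsWhere-Unique P = Uniqueₚ.filter⁺ (λ b → T? (P b)) B-Unique

    bad-occupied : ∀ {b} S → b ∈ badBins S → T (0 <ᵇ occupancy b S)
    bad-occupied S b∈ with x , x∈ , _ , refl ← ∈-badBins⁻ S b∈ = <⇒<ᵇ (∈⇒occupancy>0 (∈-map⁺ entry-bin x∈))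

    bad∈B : ∀ {b} S → (∀ {x} → x ∈ S → x ∈ H₂) → b ∈ badBins S → b ∈ B
    bad∈B S S⊆ b∈ with x , x∈ , _ , refl ← ∈-badBins⁻ S b∈ = ∈B (S⊆ x∈)

    b₁≤K₁ : length (badBins S₁) ≤ K₁
    b₁≤K₁ = Unique-⊆⇒length≤ (bad-unique bisected₁) λ b∈ →
      ∈-binsWhere⁺ (λ b → 0 <ᵇ quarters b) (bad∈B S₁ (∈-++⁺ʳ S₂ ∘ ∈-++⁺ˡ) b∈) (bad-occupied S₁ b∈)

    -- A bad 1/3-square goes to a bin with at most four 1/4-squares. That count is final before the
    -- third phase, so the bin still satisfies `badThird` at the end.
    b₂≤K₂ : length (badBins S₂) ≤ K₂
    b₂≤K₂ = Unique-⊆⇒length≤ (bad-unique bisected₂) λ {b} b∈ →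
      ∈-binsWhere⁺ (λ b → badThird (quarters b) (thirds b)) (bad∈B S₂ ∈-++⁺ˡ b∈)
        (Equivalence.from (T-∧ {0 <ᵇ thirds b} {quarters b ≤ᵇ 4})
          (bad-occupied S₂ b∈ , subst T (sym (All.lookup (bad-open bisected₂) b∈)) _))

    ∈S₀⇒∈H₀ : map entry-bin S₀ ⊆ map entry-bin H₀
    ∈S₀⇒∈H₀ {b} b∈ = subst (b ∈_) (sym (map-++ entry-bin S₀ [])) (∈-++⁺ˡ b∈)

    length-H₀ : length H₀ ≡ 144 * M
    length-H₀ = trans (length-++ S₀) (trans (+-identityʳ (length S₀)) length₀)

    sizes-H₀ : All (λ e → size e ≡ 37 * U) H₀
    sizes-H₀ = Allₚ.++⁺ sizes₀ []

    tiny-caps : ∀ (cap : Role → ℕ) → 37 * U ≤ cap tiny → All (λ (ρ , k) → k ≤ cap ρ) (role-entries tiny H₀)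
    tiny-caps cap le = Allₚ.map⁺ (All.map (λ eq → ≤-trans (≤-reflexive eq) le) sizes-H₀)

    stop₀ : 219 * M ≤ 125 * length where₀ → Outcome r ε Q₀
    stop₀ ratio =
      let E , E≡ , packing , bins = pack-items M 0 gridBins [] _ _ (role-entries tiny H₀) enough (tiny-caps (λ ρ → value (cap ρ)) ≤-refl)
      in stop-history p e ε Q₀ M H₀ E where₀ 0<ε Q₀≤M 0<M played₀ valid₀
          (trans E≡ (sym (map-∘ H₀))) (to-D {0} {U} refl packing) (subst (λ Q → All (λ s → square-bin s < Q) E) (+-identityʳ M) bins)
          (binsWhere-Unique (λ b → 0 <ᵇ tinies b))
          (λ {b} b∈ → ∈S₀⇒∈H₀ (occupancy>0⇒∈ (<ᵇ⇒< 0 (tinies b) (proj₂ (∈-binsWhere⁻ (λ b → 0 <ᵇ tinies b) b∈)))))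
          (ratio-≤ 125 219 p (suc e) M (length where₀) p≤ ratio)
      where
      open Quarter
      -- Tiny slots have constant affine coordinates, so any split of U would do; γ = 0 is taken.
      open Realise 0 U
      enough : ∀ ρ → count ρ (role-entries tiny H₀) ≤ M * count ρ gridBins + 0
      enough ρ = ≤-trans (≤-reflexive (trans (count-role-entries ρ tiny H₀) (cong (tally ρ tiny *_) length-H₀))) (by-role ρ)
        where
        by-role : ∀ ρ → tally ρ tiny * (144 * M) ≤ M * count ρ gridBins + 0
        by-role tiny = ≤-reflexive (solve 1 (λ M → con 1 :* (con 144 :* M) := M :* con 144 :+ con 0) refl M)
          where
          open +-*-Solver
        by-role middle = z≤n
        by-role good = z≤n
        by-role bad = z≤n
        by-role big = z≤n

    module QuarterStop where

      open Large 359 120 γ₁ hi₁ refl (≤ᵇ⇒≤ 241 359 _) γ₁<hi₁ (hi≤U bisected₁) public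
      open Quarter
      open Realise γ₁ slack using (pack-items; value)

      f c g b : ℕ
      g = goodCount S₁
      b = length (badBins S₁)
      -- Rounded down to keep 5 f ≤ g for the ratio; the offline packing uses f + 1 and c + 1 bins
      -- to house the remainders.
      f = g / 5
      c = b / 9

      g+b : g + b ≡ 48 * M
      g+b = trans (good+bad S₁) length₁

      48M≤ : 48 * M ≤ (f + 1) * 5 + (c + 1) * 9
      48M≤ = ≤-trans (≤-reflexive (sym g+b)) (+-mono-≤ (≤-roundUp g 5) (≤-roundUp b 9))

      M≤Q : M ≤ (f + 1) + (c + 1)
      M≤Q = *-cancelˡ-≤ 9 (begin
        9 * M                            ≤⟨ *-monoˡ-≤ M (≤ᵇ⇒≤ 9 48 _) ⟩
        48 * M                           ≤⟨ 48M≤ ⟩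
        (f + 1) * 5 + (c + 1) * 9        ≤⟨ +-monoˡ-≤ ((c + 1) * 9) (*-monoʳ-≤ (f + 1) (≤ᵇ⇒≤ 5 9 _)) ⟩
        (f + 1) * 9 + (c + 1) * 9        ≡⟨ solve 2 (λ x y → x :* con 9 :+ y :* con 9 := con 9 :* (x :+ y)) refl (f + 1) (c + 1) ⟩
        9 * ((f + 1) + (c + 1))          ∎)
        where
        open ≤-Reasoning
        open +-*-Solver

      module _ (SX : List Entry) (playedX : Played (SX ++ H₁)) (sizesX : All (λ e → size e ≡ K) SX) (lengthX : length SX ≡ f) where

        validX : All ValidSize (SX ++ H₁)
        validX = Allₚ.++⁺ (All.map (λ {e} eq → subst (λ k → (0 < k) × (k ≤ D)) (sym eq) large-valid) sizesX) valid₁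

        packingX : GridPacking D (map (roundedEntry d) (SX ++ H₁))
        packingX = played-packing playedX validX

        -- By `blocked`, a bin with a 1/4-square also has a bad one, and `large-and-bad` applies.
        -- Without 1/4-squares the tiny ones must do it: a side above 9/13 takes 81 of the 144
        -- points, and 81 + 64 = 145.
        disjoint : ∀ {b} → b ∈ where₁ → b ∉ map entry-bin SX
        disjoint {b} b∈ b∈X with Equivalence.to (T-∨ {0 <ᵇ quarters b}) (proj₂ (∈-binsWhere⁻ (λ b → closedQuarter (tinies b) (quarters b)) b∈))
        ... | inj₁ k>0 with x , x∈ , refl ← ∈-map⁻ entry-bin (occupancy>0⇒∈ {b} {S₁} (<ᵇ⇒< 0 (quarters b) k>0))
            = large-avoids-bad packingX sizesX (All.map (λ h eq → proj₁ (h eq)) (bads bisected₁)) large-and-bad b∈X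
                (All.lookup (blocked bisected₁) x∈ refl)
        ... | inj₂ s≥64 = <⇒≱ (≤ᵇ⇒≤ 145 145 _) (begin
            81 + 64                                                  ≤⟨ +-mono-≤ (*-monoʳ-≤ 81 (∈⇒occupancy>0 b∈X)) (≤ᵇ⇒≤ 64 (tinies b) s≥64) ⟩
            81 * occupancy b SX + tinies b                           ≤⟨ +-monoʳ-≤ (81 * occupancy b SX) (≤-trans (≤-reflexive (solve 1 (λ s → s := con 1 :* s :+ con 0) refl (tinies b))) (m≤n+m _ (9 * quarters b))) ⟩
            81 * occupancy b SX + (9 * quarters b + (1 * tinies b + 0))
              ≤⟨ weighted-occupancy 13 ((9 , SX) ∷ (3 , S₁) ∷ (1 , S₀) ∷ []) packingX
                   (heavies 9 13 359 _ (All.map (λ eq → ≤-trans lower-K (≤-reflexive (sym eq))) sizesX) ∷ heavies′ 3 13 120 _ lower₁ ∷ heavies 1 13 37 _ lower₀ ∷ []) b ⟩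
            144                                                      ∎)
            where
            open ≤-Reasoning
            open +-*-Solver

        where₁⊆ : where₁ ⊆ map entry-bin H₁
        where₁⊆ {b} b∈ with Equivalence.to (T-∨ {0 <ᵇ quarters b}) (proj₂ (∈-binsWhere⁻ (λ b → closedQuarter (tinies b) (quarters b)) b∈))
        ... | inj₁ k>0 = subst (b ∈_) (sym (map-++ entry-bin S₁ H₀)) (∈-++⁺ˡ (occupancy>0⇒∈ {S = S₁} (<ᵇ⇒< 0 (quarters b) k>0)))
        ... | inj₂ s≥64 = subst (b ∈_) (sym (map-++ entry-bin S₁ H₀)) (∈-++⁺ʳ (map entry-bin S₁)
              (∈S₀⇒∈H₀ (occupancy>0⇒∈ {S = S₀} (≤-trans (s≤s z≤n) (≤ᵇ⇒≤ 64 (tinies b) s≥64)))))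

        items : List (Role × ℕ)
        items = role-entries big SX ++ (map adaptive-role S₁ ++ role-entries tiny H₀)

        items-sizes : map proj₂ items ≡ map size (SX ++ H₁)
        items-sizes = trans (map-++ proj₂ (role-entries big SX) _) (trans (cong₂ _++_ (sym (map-∘ SX))
          (trans (map-++ proj₂ (map adaptive-role S₁) _) (trans (cong₂ _++_ (sym (map-∘ S₁)) (sym (map-∘ H₀))) (sym (map-++ size S₁ H₀)))))
          (sym (map-++ size SX H₁)))

        items-count : ∀ ρ → count ρ items ≡ tally ρ big * f + ((tally ρ good * g + tally ρ bad * b) + tally ρ tiny * (144 * M))
        items-count ρ = trans (count-++ ρ (role-entries big SX) _) (cong₂ _+_
          (trans (count-role-entries ρ big SX) (cong (tally ρ big *_) lengthX))
          (trans (count-++ ρ (map adaptive-role S₁) _) (cong₂ _+_ (count-adaptive ρ S₁)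
            (trans (count-role-entries ρ tiny H₀) (cong (tally ρ tiny *_) length-H₀)))))

        enough : ∀ ρ → count ρ items ≤ (f + 1) * count ρ largeBins + (c + 1) * count ρ smallBins
        enough ρ = ≤-trans (≤-reflexive (items-count ρ)) (by-role ρ)
          where
          open ≤-Reasoning
          open +-*-Solver
          by-role : ∀ ρ → tally ρ big * f + ((tally ρ good * g + tally ρ bad * b) + tally ρ tiny * (144 * M)) ≤
                          (f + 1) * count ρ largeBins + (c + 1) * count ρ smallBins
          -- There are three tiny squares per 1/4-square; a large bin offers 18 ≥ 3 · 5 slots, a
          -- small one exactly 27 = 3 · 9.
          by-role tiny = begin
            1 * (144 * M)                            ≡⟨ solve 1 (λ M → con 1 :* (con 144 :* M) := con 3 :* (con 48 :* M)) refl M ⟩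
            3 * (48 * M)                             ≤⟨ *-monoʳ-≤ 3 48M≤ ⟩
            3 * ((f + 1) * 5 + (c + 1) * 9)          ≡⟨ solve 2 (λ x y → con 3 :* (x :* con 5 :+ y :* con 9) := x :* con 15 :+ y :* con 27) refl (f + 1) (c + 1) ⟩
            (f + 1) * 15 + (c + 1) * 27              ≤⟨ +-monoˡ-≤ ((c + 1) * 27) (*-monoʳ-≤ (f + 1) (≤ᵇ⇒≤ 15 18 _)) ⟩
            (f + 1) * 18 + (c + 1) * 27              ∎
          by-role middle = z≤n
          by-role good = ≤-trans (≤-reflexive (solve 1 (λ g → con 1 :* g :+ con 0 :+ con 0 := g) refl g)) (≤-trans (≤-roundUp g 5) (m≤m+n _ _))
          by-role bad = ≤-trans (≤-reflexive (solve 1 (λ b → con 1 :* b :+ con 0 := b) refl b)) (≤-trans (≤-roundUp b 9) (m≤n+m _ _))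
          by-role big = ≤-trans (≤-reflexive (solve 1 (λ f → con 1 :* f :+ con 0 := f) refl f))
            (≤-trans (m≤m+n f 1) (≤-trans (≤-reflexive (sym (*-identityʳ (f + 1)))) (m≤m+n _ _)))

        caps : All (λ (ρ , k) → k ≤ value (cap ρ)) items
        caps = Allₚ.++⁺ (Allₚ.map⁺ (All.map ≤-reflexive sizesX)) (Allₚ.++⁺
          (adaptive-caps (λ ρ → value (cap ρ)) (≤-reflexive (good-cap 120)) (≤-reflexive (bad-cap 120)) bisected₁)
          (tiny-caps (λ ρ → value (cap ρ)) (≤-reflexive (tiny-cap 37))))

        stop₁ : 219 * ((f + 1) + (c + 1)) ≤ 125 * (length where₁ + f) → Outcome r ε Q₀
        stop₁ ratio =
          let E , E≡ , packing , bins = pack-items (f + 1) (c + 1) largeBins smallBins _ _ items enough caps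
          in finish K f ((f + 1) + (c + 1)) playedX validX packingX sizesX lengthX two-large
               (binsWhere-Unique (λ b → closedQuarter (tinies b) (quarters b))) where₁⊆ disjoint
               (trans E≡ items-sizes) (to-D {γ₁} {slack} split packing) bins M≤Q ratio

    module ThirdStop where

      open Large 319 160 γ₂ hi₂ refl (≤ᵇ⇒≤ 241 319 _) γ₂<hi₂ (hi≤U bisected₂) public
      open Third
      open Realise γ₂ slack using (pack-items; value)

      f c g b : ℕ
      g = goodCount S₂
      b = length (badBins S₂)
      f = g / 3
      c = b / 4

      g+b : g + b ≡ 72 * M
      g+b = trans (good+bad S₂) length₂

      72M≤ : 72 * M ≤ (f + 1) * 3 + (c + 1) * 4
      72M≤ = ≤-trans (≤-reflexive (sym g+b)) (+-mono-≤ (≤-roundUp g 3) (≤-roundUp b 4))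

      M≤Q : M ≤ (f + 1) + (c + 1)
      M≤Q = *-cancelˡ-≤ 4 (begin
        4 * M                            ≤⟨ *-monoˡ-≤ M (≤ᵇ⇒≤ 4 72 _) ⟩
        72 * M                           ≤⟨ 72M≤ ⟩
        (f + 1) * 3 + (c + 1) * 4        ≤⟨ +-monoˡ-≤ ((c + 1) * 4) (*-monoʳ-≤ (f + 1) (≤ᵇ⇒≤ 3 4 _)) ⟩
        (f + 1) * 4 + (c + 1) * 4        ≡⟨ solve 2 (λ x y → x :* con 4 :+ y :* con 4 := con 4 :* (x :+ y)) refl (f + 1) (c + 1) ⟩
        4 * ((f + 1) + (c + 1))          ∎)
        where
        open ≤-Reasoning
        open +-*-Solver

      module _ (SX : List Entry) (playedX : Played (SX ++ H₂)) (sizesX : All (λ e → size e ≡ K) SX) (lengthX : length SX ≡ f) where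

        validX : All ValidSize (SX ++ H₂)
        validX = Allₚ.++⁺ (All.map (λ {e} eq → subst (λ k → (0 < k) × (k ≤ D)) (sym eq) large-valid) sizesX) valid₂

        packingX : GridPacking D (map (roundedEntry d) (SX ++ H₂))
        packingX = played-packing playedX validX

        lowerX : All (λ e → 319 * U ≤ size e) SX
        lowerX = All.map (λ eq → ≤-trans lower-K (≤-reflexive (sym eq))) sizesX

        disjoint : ∀ {b} → b ∈ where₂ → b ∉ map entry-bin SX
        disjoint {b} b∈ b∈X = closed (Equivalence.to (T-∨ {0 <ᵇ thirds b})
          (proj₂ (∈-binsWhere⁻ (λ b → closedThird (tinies b) (quarters b) (thirds b)) b∈)))
          where
          open +-*-Solver
          1≤X : 1 ≤ occupancy b SX
          1≤X = ∈⇒occupancy>0 b∈X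
          -- A large square exceeds 2/4 and 8/13 of a bin. It takes 4 of the 9 points used here and
          -- 64 of the 144 points in `light`, which explains the thresholds 6 and 81 of
          -- `closedThird`.
          few : 4 + (thirds b + quarters b) ≤ 9
          few = begin
            4 + (thirds b + quarters b)                                  ≤⟨ +-monoˡ-≤ (thirds b + quarters b) (*-monoʳ-≤ 4 1≤X) ⟩
            4 * occupancy b SX + (thirds b + quarters b)
              ≡⟨ solve 3 (λ x t k → con 4 :* x :+ (t :+ k) := con 4 :* x :+ (con 1 :* t :+ (con 1 :* k :+ con 0))) refl (occupancy b SX) (thirds b) (quarters b) ⟩
            4 * occupancy b SX + (1 * thirds b + (1 * quarters b + 0))
              ≤⟨ weighted-occupancy 4 ((2 , SX) ∷ (1 , S₂) ∷ (1 , S₁) ∷ (0 , S₀) ∷ []) packingX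
                   (heavies 2 4 319 _ lowerX ∷ heavies′ 1 4 160 _ lower₂ ∷ heavies′ 1 4 120 _ lower₁ ∷ heavies 0 4 37 _ lower₀ ∷ []) b ⟩
            9                                                            ∎
            where
            open ≤-Reasoning
          light : 64 + (tinies b + 9 * quarters b) ≤ 144
          light = begin
            64 + (tinies b + 9 * quarters b)                             ≤⟨ +-mono-≤ (*-monoʳ-≤ 64 1≤X) (m≤n+m _ (16 * thirds b)) ⟩
            64 * occupancy b SX + (16 * thirds b + (tinies b + 9 * quarters b))
              ≡⟨ solve 4 (λ x t k s → con 64 :* x :+ (con 16 :* t :+ (s :+ con 9 :* k)) := con 64 :* x :+ (con 16 :* t :+ (con 9 :* k :+ (con 1 :* s :+ con 0)))) refl
                   (occupancy b SX) (thirds b) (quarters b) (tinies b) ⟩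
            64 * occupancy b SX + (16 * thirds b + (9 * quarters b + (1 * tinies b + 0)))
              ≤⟨ weighted-occupancy 13 ((8 , SX) ∷ (4 , S₂) ∷ (3 , S₁) ∷ (1 , S₀) ∷ []) packingX
                   (heavies 8 13 319 _ lowerX ∷ heavies′ 4 13 160 _ lower₂ ∷ heavies′ 3 13 120 _ lower₁ ∷ heavies 1 13 37 _ lower₀ ∷ []) b ⟩
            144                                                          ∎
            where
            open ≤-Reasoning
          closed : T (0 <ᵇ thirds b) ⊎ T ((6 ≤ᵇ quarters b) ∨ (81 ≤ᵇ tinies b + 9 * quarters b)) → ⊥
          closed (inj₁ t>0) with quarters b ≤? 4
          ... | no k≰4 = <⇒≱ (≤ᵇ⇒≤ 10 10 _) (≤-trans (+-monoʳ-≤ 4 (+-mono-≤ (<ᵇ⇒< 0 (thirds b) t>0) (≰⇒> k≰4))) few)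
          ... | yes k≤4 with x , x∈ , refl ← ∈-map⁻ entry-bin (occupancy>0⇒∈ {b} {S₂} (<ᵇ⇒< 0 (thirds b) t>0))
              = large-avoids-bad packingX sizesX (All.map (λ h eq → proj₁ (h eq)) (bads bisected₂)) large-and-bad b∈X
                  (All.lookup (blocked bisected₂) x∈ (Equivalence.to T-≡ (≤⇒≤ᵇ k≤4)))
          closed (inj₂ h) with Equivalence.to (T-∨ {6 ≤ᵇ quarters b}) h
          ... | inj₁ k≥6 = <⇒≱ (≤ᵇ⇒≤ 10 10 _) (≤-trans (+-monoʳ-≤ 4 (≤-trans (≤ᵇ⇒≤ 6 (quarters b) k≥6) (m≤n+m _ (thirds b)))) few)
          ... | inj₂ big-area = <⇒≱ (≤ᵇ⇒≤ 145 145 _) (≤-trans (+-monoʳ-≤ 64 (≤ᵇ⇒≤ 81 (tinies b + 9 * quarters b) big-area)) light)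

        where₂⊆ : where₂ ⊆ map entry-bin H₂
        where₂⊆ b∈ = ∈-deduplicate⁻ _≟_ (map entry-bin H₂)
          (proj₁ (∈-binsWhere⁻ (λ b → closedThird (tinies b) (quarters b) (thirds b)) b∈))

        items : List (Role × ℕ)
        items = role-entries big SX ++ (map adaptive-role S₂ ++ (role-entries middle S₁ ++ role-entries tiny H₀))

        items-sizes : map proj₂ items ≡ map size (SX ++ H₂)
        items-sizes = trans (map-++ proj₂ (role-entries big SX) _) (trans (cong₂ _++_ (sym (map-∘ SX))
          (trans (map-++ proj₂ (map adaptive-role S₂) _) (trans (cong₂ _++_ (sym (map-∘ S₂))
            (trans (map-++ proj₂ (role-entries middle S₁) _) (trans (cong₂ _++_ (sym (map-∘ S₁)) (sym (map-∘ H₀))) (sym (map-++ size S₁ H₀)))))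
            (sym (map-++ size S₂ H₁)))))
          (sym (map-++ size SX H₂)))

        items-count : ∀ ρ → count ρ items ≡
          tally ρ big * f + ((tally ρ good * g + tally ρ bad * b) + (tally ρ middle * (48 * M) + tally ρ tiny * (144 * M)))
        items-count ρ = trans (count-++ ρ (role-entries big SX) _) (cong₂ _+_
          (trans (count-role-entries ρ big SX) (cong (tally ρ big *_) lengthX))
          (trans (count-++ ρ (map adaptive-role S₂) _) (cong₂ _+_ (count-adaptive ρ S₂)
            (trans (count-++ ρ (role-entries middle S₁) _) (cong₂ _+_
              (trans (count-role-entries ρ middle S₁) (cong (tally ρ middle *_) length₁))
              (trans (count-role-entries ρ tiny H₀) (cong (tally ρ tiny *_) length-H₀)))))))

        enough : ∀ ρ → count ρ items ≤ (f + 1) * count ρ largeBins + (c + 1) * count ρ smallBins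
        enough ρ = ≤-trans (≤-reflexive (items-count ρ)) (by-role ρ)
          where
          open ≤-Reasoning
          open +-*-Solver
          by-role : ∀ ρ → tally ρ big * f + ((tally ρ good * g + tally ρ bad * b) + (tally ρ middle * (48 * M) + tally ρ tiny * (144 * M))) ≤
                          (f + 1) * count ρ largeBins + (c + 1) * count ρ smallBins
          -- Two tiny squares per 1/3-square, matched exactly by 6 slots for three and 8 for four.
          by-role tiny = begin
            1 * (144 * M)                            ≡⟨ solve 1 (λ M → con 1 :* (con 144 :* M) := con 2 :* (con 72 :* M)) refl M ⟩
            2 * (72 * M)                             ≤⟨ *-monoʳ-≤ 2 72M≤ ⟩
            2 * ((f + 1) * 3 + (c + 1) * 4)          ≡⟨ solve 2 (λ x y → con 2 :* (x :* con 3 :+ y :* con 4) := x :* con 6 :+ y :* con 8) refl (f + 1) (c + 1) ⟩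
            (f + 1) * 6 + (c + 1) * 8                ∎
          -- Two 1/4-squares per three 1/3-squares: exact in large bins, while a small bin has 3
          -- slots against 8/3 required. The spare `c + 1` is this surplus after multiplication by
          -- 3.
          by-role middle = *-cancelˡ-≤ 3 (begin
            3 * (1 * (48 * M) + 0)                   ≡⟨ solve 1 (λ M → con 3 :* (con 1 :* (con 48 :* M) :+ con 0) := con 2 :* (con 72 :* M)) refl M ⟩
            2 * (72 * M)                             ≤⟨ *-monoʳ-≤ 2 72M≤ ⟩
            2 * ((f + 1) * 3 + (c + 1) * 4)          ≤⟨ m≤m+n _ (c + 1) ⟩
            2 * ((f + 1) * 3 + (c + 1) * 4) + (c + 1)
              ≡⟨ solve 2 (λ x y → con 2 :* (x :* con 3 :+ y :* con 4) :+ y := con 3 :* (x :* con 2 :+ y :* con 3)) refl (f + 1) (c + 1) ⟩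
            3 * ((f + 1) * 2 + (c + 1) * 3)          ∎)
          by-role good = ≤-trans (≤-reflexive (solve 1 (λ g → con 1 :* g :+ con 0 :+ con 0 := g) refl g)) (≤-trans (≤-roundUp g 3) (m≤m+n _ _))
          by-role bad = ≤-trans (≤-reflexive (solve 1 (λ b → con 1 :* b :+ con 0 := b) refl b)) (≤-trans (≤-roundUp b 4) (m≤n+m _ _))
          by-role big = ≤-trans (≤-reflexive (solve 1 (λ f → con 1 :* f :+ con 0 := f) refl f))
            (≤-trans (m≤m+n f 1) (≤-trans (≤-reflexive (sym (*-identityʳ (f + 1)))) (m≤m+n _ _)))

        caps : All (λ (ρ , k) → k ≤ value (cap ρ)) items
        caps = Allₚ.++⁺ (Allₚ.map⁺ (All.map ≤-reflexive sizesX)) (Allₚ.++⁺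
          (adaptive-caps (λ ρ → value (cap ρ)) (≤-reflexive (good-cap 160)) (≤-reflexive (bad-cap 160)) bisected₂)
          (Allₚ.++⁺ (Allₚ.map⁺ (All.map (λ (_ , hi) → ≤-trans hi (≤-reflexive (bad-cap 120))) ranges₁))
            (tiny-caps (λ ρ → value (cap ρ)) (≤-reflexive (tiny-cap 37)))))

        stop₂ : 219 * ((f + 1) + (c + 1)) ≤ 125 * (length where₂ + f) → Outcome r ε Q₀
        stop₂ ratio =
          let E , E≡ , packing , bins = pack-items (f + 1) (c + 1) largeBins smallBins _ _ items enough caps
          in finish K f ((f + 1) + (c + 1)) playedX validX packingX sizesX lengthX two-large
               (binsWhere-Unique (λ b → closedThird (tinies b) (quarters b) (thirds b))) where₂⊆ disjoint
               (trans E≡ items-sizes) (to-D {γ₂} {slack} split packing) bins M≤Q ratio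

    -- The number of large squares at each stop is known from the played history, so the ratios are
    -- tested before any of them is presented. They then extend `H₁` or `H₂`; the continuation of
    -- `H₁` by large squares is a branch apart from the 1/3-squares.
    outcome : Outcome r ε Q₀
    outcome with 219 * M ≤? 125 * length where₀
    ... | yes h₀ = stop₀ h₀
    ... | no ¬h₀ with 219 * ((QuarterStop.f + 1) + (QuarterStop.c + 1)) ≤? 125 * (length where₁ + QuarterStop.f)
    ...   | yes h₁ = let SX , playedX , sizesX , lengthX = repeat QuarterStop.f QuarterStop.K H₁ (played bisected₁)
                   in QuarterStop.stop₁ SX playedX sizesX lengthX h₁
    ...   | no ¬h₁ with 219 * ((ThirdStop.f + 1) + (ThirdStop.c + 1)) ≤? 125 * (length where₂ + ThirdStop.f)
    ...     | yes h₂ = let SX , playedX , sizesX , lengthX = repeat ThirdStop.f ThirdStop.K H₂ (played bisected₂)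
                     in ThirdStop.stop₂ SX playedX sizesX lengthX h₂
    ...     | no ¬h₂ = ⊥-elim (no-algorithm-beats-all-stops {M} {length where₀} {length where₁} {length where₂}
                {QuarterStop.f} {QuarterStop.c} {QuarterStop.g} {QuarterStop.b} {K₁}
                {ThirdStop.f} {ThirdStop.c} {ThirdStop.g} {ThirdStop.b} {K₂} M≥ total
                b₁≤K₁ (roundDown-≤ QuarterStop.g 5) (roundDown-≤ QuarterStop.b 9) QuarterStop.g+b
                b₂≤K₂ (roundDown-≤ ThirdStop.g 3) (roundDown-≤ ThirdStop.b 4) ThirdStop.g+b
                (<⇒≤ (≰⇒> ¬h₀)) (<⇒≤ (≰⇒> ¬h₁)) (<⇒≤ (≰⇒> ¬h₂)))

  -- Each phase leaves as spare exponent the number of squares of the other phase, so the same U,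
  -- and hence the same grid, serves both bisections.
  outcome : Outcome r ε Q₀
  outcome
    with S₀ , played₀ , sizes₀ , length₀ ← repeat (144 * M) (37 * U) [] refl
    with S₁ , γ₁ , bisected₁ , length₁ ← bisect (48 * M) (72 * M)
           (start (120 * U) (λ _ → true) (48 * M) (72 * M) (sym U≡) played₀)
    with S₂ , γ₂ , bisected₂ , length₂ ← bisect (72 * M) (48 * M)
           (start (160 * U) (fewQuarters S₁) (72 * M) (48 * M)
             (trans (cong (2 ^_) (+-comm (72 * M) (48 * M))) (sym U≡)) (played bisected₁))
    = Run.outcome S₀ S₁ S₂ γ₁ (γ₁ + 2 ^ (72 * M)) γ₂ (γ₂ + 2 ^ (48 * M))
        (m<m+n γ₁ (m^n>0 2 (72 * M))) (m<m+n γ₂ (m^n>0 2 (48 * M)))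
        played₀ sizes₀ bisected₁ bisected₂ length₀
        (trans length₁ (+-identityʳ (48 * M))) (trans length₂ (+-identityʳ (72 * M)))

-- U is a variable with an equation, so that the huge power of two stays folded in the types.
outcome-at-scale : ∀ (A : OnlineAlg) ε → 0ℚ ℚ.< ε → ∀ Q₀ M U p e → 254 ≤ M → Q₀ ≤ M → U ≡ 2 ^ (48 * M + 72 * M) →
  p * 125 ≤ 219 * suc e → Play.Outcome A (480 * U ∸ 1) ((ℤ.+ p) ℚ./ suc e) ε Q₀
outcome-at-scale A ε 0<ε Q₀ M U p e M≥ Q₀≤M U≡ p≤ =
  Adversary.outcome A ε 0<ε Q₀ M U (480 * U ∸ 1) p e M≥ Q₀≤M U≡
    (m+[n∸m]≡n (*-mono-≤ {1} {480} (s≤s z≤n) (subst (1 ≤_) (sym U≡) (m^n>0 2 (48 * M + 72 * M))))) p≤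

ratio-at-least : ∀ A p e → p * 125 ≤ 219 * suc e → RatioAtLeast A ((ℤ.+ p) ℚ./ suc e)
ratio-at-least A p e p≤ ε 0<ε Q₀ =
  outcome-at-scale A ε 0<ε Q₀ (254 + Q₀) _ p e (m≤m+n 254 Q₀) (m≤n+m Q₀ 254) refl p≤

theorem3 : (A : OnlineAlg) → RatioAtLeast A lowerBound
-- The check is 2189430625 ≤ 2190000000, that is, 1.7515445 ≤ 219/125; the second argument is the
-- denominator minus one.
theorem3 A = ratio-at-least A 17515445 9999999 (≤ᵇ⇒≤ (17515445 * 125) (219 * 10000000) _)
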